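{- For any two $\mathcal{ELH}^r$-TBoxes $\mathcal{T}_1$ and $\mathcal{T}_2$ and any signature $\Sigma$: if $\varphi\in\mathsf{qDiff}_\Sigma(\mathcal{T}_1,\mathcal{T}_2)$, then there exists $\varphi'\in\mathsf{cDiff}^{\mathsf{ran},\sqcap,u}_\Sigma(\mathcal{T}_1,\mathcal{T}_2)$ with $\mathsf{sig}(\varphi')\subseteq\mathsf{sig}(\varphi)$.
   Context: $\mathsf{N_C},\mathsf{N_R},\mathsf{N_I}$ are countably infinite, mutually disjoint sets of concept names, role names and individual names. $\mathcal{EL}$-concepts: $C ::= A \mid \top \mid C\sqcap D \mid \exists r.C$ with $A\in\mathsf{N_C}$, $r\in\mathsf{N_R}$. $\mathcal{ELH}^r$-inclusions are: concept inclusions $C\sqsubseteq D$, $\mathsf{ran}(r)\sqsubseteq D$, $\mathsf{ran}(r)\sqcap C\sqsubseteq D$; concept equations $C\equiv D$; role inclusions $r\sqsubseteq s$ (with $C,D$ $\mathcal{EL}$-concepts, $r,s\in\mathsf{N_R}$). An $\mathcal{ELH}^r$-TBox is a finite set of $\mathcal{ELH}^r$-inclusions. $\mathcal{C}^{\mathsf{ran}}$-concepts: $C ::= A\mid\top\mid\mathsf{ran}(r)\mid C\sqcap D\mid\exists r.C$. $\mathcal{C}^{\sqcap,u}$-concepts: $C ::= A\mid\top\mid C\sqcap D\mid\exists R.C\mid\exists u.C$, where $R=r_1\sqcap\cdots\sqcap r_n$, $n\ge1$, $r_i\in\mathsf{N_R}$, and $u$ (the universal role) is a logical symbol not in $\mathsf{N_R}$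 (not belonging to any $\mathsf{sig}$). $\mathcal{EL}^{\mathsf{ran},\sqcap,u}$-inclusions are concept inclusions $C\sqsubseteq D$ with $C$ a $\mathcal{C}^{\mathsf{ran}}$-concept and $D$ a $\mathcal{C}^{\sqcap,u}$-concept, and role inclusions $r\sqsubseteq s$. Semantics: an interpretation $\mathcal{I}=(\Delta^{\mathcal I},\cdot^{\mathcal I})$ has a nonempty domain, $A^{\mathcal I}\subseteq\Delta^{\mathcal I}$, $r^{\mathcal I}\subseteq\Delta^{\mathcal I}\times\Delta^{\mathcal I}$, $a^{\mathcal I}\in\Delta^{\mathcal I}$; $\top^{\mathcal I}=\Delta^{\mathcal I}$, $(C\sqcap D)^{\mathcal I}=C^{\mathcal I}\cap D^{\mathcal I}$, $(r_1\sqcap\cdots\sqcap r_n)^{\mathcal I}=\bigcap_i r_i^{\mathcal I}$, $u^{\mathcal I}=\Delta^{\mathcal I}\times\Delta^{\mathcal I}$, $(\exists R.C)^{\mathcal I}=\{d\mid\exists e\in C^{\mathcal I}:(d,e)\in R^{\mathcal I}\}$, $\mathsf{ran}(r)^{\mathcal I}=\{d\mid\exists e:(e,d)\in r^{\mathcal I}\}$. Inclusions (equations) are satisfied if the corresponding set inclusion (equality) holds. $\mathcal T\models\alpha$ means every model of $\mathcal T$ satisfies $\alpha$. An ABox is a nonempty finite set of assertions $\top(a)$, $A(a)$, $r(a,b)$ with their usual meaning in interpretations. A conjunctive query is a first-order formula $q(\vec x)=\exists\vec y\,\psi(\vec x,\vec y)$ with $\psi$ a conjunction of atoms $A(t)$,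 $r(t_1,t_2)$ whose terms are individual names or variables from $\vec x,\vec y$. For a tuple $\vec a$ of individual names in $\mathcal A$, $(\mathcal T,\mathcal A)\models q(\vec a)$ means that $q(\vec a)$ is true in every model of $\mathcal T$ and $\mathcal A$. A signature is a subset $\Sigma\subseteq\mathsf{N_C}\cup\mathsf{N_R}$; $\mathsf{sig}(E)$ is the set of concept and role names occurring in $E$ (for a pair $(\mathcal A,q(\vec a))$, in either component); a $\Sigma$-object is one with $\mathsf{sig}\subseteq\Sigma$. $\mathsf{cDiff}^{\mathsf{ran},\sqcap,u}_\Sigma(\mathcal T_1,\mathcal T_2)$ is the set of all $\mathcal{EL}^{\mathsf{ran},\sqcap,u}$-inclusions $\alpha$ over $\Sigma$ with $\mathcal T_1\models\alpha$ and $\mathcal T_2\not\models\alpha$. $\mathsf{qDiff}_\Sigma(\mathcal T_1,\mathcal T_2)$ is the set of pairs $(\mathcal A,q(\vec a))$ with $\mathcal A$ a $\Sigma$-ABox, $q(\vec x)$ a conjunctive $\Sigma$-query and $\vec a$ a tuple of individual names in $\mathcal A$ such that $(\mathcal T_1,\mathcal A)\models q(\vec a)$ and $(\mathcal T_2,\mathcal A)\not\models q(\vec a)$. -}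

module Defs where

open import Level using (0ℓ; suc)
open import Data.Nat using (ℕ)
open import Data.Fin using (Fin)
open import Data.List using (List)
open import Data.List.NonEmpty using (List⁺; toList)
open import Data.List.Relation.Unary.All using (All)
open import Data.List.Relation.Unary.Any using (Any)
open import Data.Vec using (Vec; lookup)
import Data.Vec.Relation.Unary.All as Vec
open import Data.Product using (∃; _×_; _,_)
open import Data.Sum using (_⊎_; inj₁; inj₂)
open import Relation.Nullary using (¬_)
open import Relation.Unary using (Pred; _∈_; _⊆_; _≐_; _∩_; _∪_; ∅; U; ｛_｝)
open import Relation.Binary using (Rel; _⇒_)

-- Wrapping ℕ makes the three countably infinite sets of names distinct types,
-- hence mutually disjoint.

record ConceptName : Set where
  constructor conceptName
  field index : ℕ

record RoleName : Set where
  constructor roleName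
  field index : ℕ

record IndName : Set where
  constructor indName
  field index : ℕ

infixr 7 _⊓_
infixr 8 ∃⟨_⟩_ ∃u_
infix  4 _⊑_ ran⟨_⟩⊑_ ran⟨_⟩⊓_⊑_ _≡ᶜ_ _⊑ʳ_

data Concept : Set where
  name   : ConceptName → Concept
  ⊤      : Concept
  _⊓_    : Concept → Concept → Concept
  ∃⟨_⟩_  : RoleName → Concept → Concept

data ConceptRan : Set where
  name   : ConceptName → ConceptRan
  ⊤      : ConceptRan
  ran    : RoleName → ConceptRan
  _⊓_    : ConceptRan → ConceptRan → ConceptRan
  ∃⟨_⟩_  : RoleName → ConceptRan → ConceptRan

-- ∃⟨ r₁ ∷ … ∷ rₙ ⟩ C stands for ∃(r₁ ⊓ ⋯ ⊓ rₙ).C.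
data Concept⊓u : Set where
  name   : ConceptName → Concept⊓u
  ⊤      : Concept⊓u
  _⊓_    : Concept⊓u → Concept⊓u → Concept⊓u
  ∃⟨_⟩_  : List⁺ RoleName → Concept⊓u → Concept⊓u
  ∃u_    : Concept⊓u → Concept⊓u

data ELHrInclusion : Set where
  _⊑_         : Concept → Concept → ELHrInclusion
  ran⟨_⟩⊑_    : RoleName → Concept → ELHrInclusion
  ran⟨_⟩⊓_⊑_  : RoleName → Concept → Concept → ELHrInclusion
  _≡ᶜ_        : Concept → Concept → ELHrInclusion
  _⊑ʳ_        : RoleName → RoleName → ELHrInclusion

TBox : Set
TBox = List ELHrInclusion

data ELran⊓uInclusion : Set where
  _⊑_   : ConceptRan → Concept⊓u → ELran⊓uInclusion
  _⊑ʳ_  : RoleName → RoleName → ELran⊓uInclusion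

data Assertion : Set where
  top      : IndName → Assertion
  concept  : ConceptName → IndName → Assertion
  role     : RoleName → IndName → IndName → Assertion

ABox : Set
ABox = List⁺ Assertion

assertionIndividuals : Assertion → Pred IndName 0ℓ
assertionIndividuals (top a)       = ｛ a ｝
assertionIndividuals (concept A a) = ｛ a ｝
assertionIndividuals (role r a b)  = ｛ a ｝ ∪ ｛ b ｝

individuals : ABox → Pred IndName 0ℓ
individuals 𝒜 a = Any (λ α → a ∈ assertionIndividuals α) (toList 𝒜)

data Term (n m : ℕ) : Set where
  individual    : IndName → Term n m
  answerVar     : Fin n → Term n m
  quantifiedVar : Fin m → Term n m

data Atom (n m : ℕ) : Set where
  concept  : ConceptName → Term n m → Atom n m
  role     : RoleName → Term n m → Term n m → Atom n m

-- q(x₁,…,xₙ) = ∃y₁…∃yₘ. ⋀ atoms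
record ConjunctiveQuery (n : ℕ) : Set where
  constructor query
  field
    m      : ℕ
    atoms  : List (Atom n m)

-- q(a₁,…,aₙ)
record QueryInstance : Set where
  constructor _at_
  field
    {arity}  : ℕ
    cq       : ConjunctiveQuery arity
    answer   : Vec IndName arity

record Interpretation : Set₁ where
  field
    Δ         : Set
    nonempty  : Δ
    ⟦_⟧ᴬ      : ConceptName → Pred Δ 0ℓ
    ⟦_⟧ʳ      : RoleName → Rel Δ 0ℓ
    ⟦_⟧ⁱ      : IndName → Δ

  ⟦ran_⟧ : RoleName → Pred Δ 0ℓ
  ⟦ran r ⟧ d = ∃ λ e → ⟦ r ⟧ʳ e d

  ⟦_⟧⊓ : List⁺ RoleName → Rel Δ 0ℓ
  ⟦ R ⟧⊓ d e = All (λ r → ⟦ r ⟧ʳ d e) (toList R)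

  ⟦_⟧ : Concept → Pred Δ 0ℓ
  ⟦ name A ⟧     = ⟦ A ⟧ᴬ
  ⟦ ⊤ ⟧          = U
  ⟦ C ⊓ D ⟧      = ⟦ C ⟧ ∩ ⟦ D ⟧
  ⟦ ∃⟨ r ⟩ C ⟧ d = ∃ λ e → ⟦ r ⟧ʳ d e × e ∈ ⟦ C ⟧

  ⟦_⟧ran : ConceptRan → Pred Δ 0ℓ
  ⟦ name A ⟧ran     = ⟦ A ⟧ᴬ
  ⟦ ⊤ ⟧ran          = U
  ⟦ ran r ⟧ran      = ⟦ran r ⟧
  ⟦ C ⊓ D ⟧ran      = ⟦ C ⟧ran ∩ ⟦ D ⟧ran
  ⟦ ∃⟨ r ⟩ C ⟧ran d = ∃ λ e → ⟦ r ⟧ʳ d e × e ∈ ⟦ C ⟧ran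

  ⟦_⟧⊓u : Concept⊓u → Pred Δ 0ℓ
  ⟦ name A ⟧⊓u     = ⟦ A ⟧ᴬ
  ⟦ ⊤ ⟧⊓u          = U
  ⟦ C ⊓ D ⟧⊓u      = ⟦ C ⟧⊓u ∩ ⟦ D ⟧⊓u
  ⟦ ∃⟨ R ⟩ C ⟧⊓u d = ∃ λ e → ⟦ R ⟧⊓ d e × e ∈ ⟦ C ⟧⊓u
  ⟦ ∃u C ⟧⊓u d     = ∃ λ e → e ∈ ⟦ C ⟧⊓u

open Interpretation using (Δ)

module _ (ℐ : Interpretation) where
  open Interpretation ℐ hiding (Δ)

  infix 4 _⊨ᵀ_ _⊨ᴬ_ _⊨_ _⊨q_

  satisfiesELHr : ELHrInclusion → Set
  satisfiesELHr (C ⊑ D)           = ⟦ C ⟧ ⊆ ⟦ D ⟧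
  satisfiesELHr (ran⟨ r ⟩⊑ D)     = ⟦ran r ⟧ ⊆ ⟦ D ⟧
  satisfiesELHr (ran⟨ r ⟩⊓ C ⊑ D) = ⟦ran r ⟧ ∩ ⟦ C ⟧ ⊆ ⟦ D ⟧
  satisfiesELHr (C ≡ᶜ D)          = ⟦ C ⟧ ≐ ⟦ D ⟧
  satisfiesELHr (r ⊑ʳ s)          = ⟦ r ⟧ʳ ⇒ ⟦ s ⟧ʳ

  _⊨ᵀ_ : TBox → Set
  _⊨ᵀ_ 𝒯 = All satisfiesELHr 𝒯

  _⊨_ : ELran⊓uInclusion → Set
  _⊨_ (C ⊑ D)  = ⟦ C ⟧ran ⊆ ⟦ D ⟧⊓u
  _⊨_ (r ⊑ʳ s) = ⟦ r ⟧ʳ ⇒ ⟦ s ⟧ʳ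

  satisfiesAssertion : Assertion → Set
  satisfiesAssertion (top a)       = ⟦ a ⟧ⁱ ∈ U
  satisfiesAssertion (concept A a) = ⟦ a ⟧ⁱ ∈ ⟦ A ⟧ᴬ
  satisfiesAssertion (role r a b)  = ⟦ r ⟧ʳ ⟦ a ⟧ⁱ ⟦ b ⟧ⁱ

  _⊨ᴬ_ : ABox → Set
  _⊨ᴬ_ 𝒜 = All satisfiesAssertion (toList 𝒜)

  module _ {n m : ℕ} (π : Fin n → Δ ℐ) (ρ : Fin m → Δ ℐ) where

    ⟦_⟧ᵗ : Term n m → Δ ℐ
    ⟦ individual a ⟧ᵗ    = ⟦ a ⟧ⁱ
    ⟦ answerVar i ⟧ᵗ     = π i
    ⟦ quantifiedVar j ⟧ᵗ = ρ j

    satisfiesAtom : Atom n m → Set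
    satisfiesAtom (concept A t) = ⟦ t ⟧ᵗ ∈ ⟦ A ⟧ᴬ
    satisfiesAtom (role r t t′) = ⟦ r ⟧ʳ ⟦ t ⟧ᵗ ⟦ t′ ⟧ᵗ

  _⊨q_ : QueryInstance → Set
  _⊨q_ (query m ψ at a⃗) =
    ∃ λ (ρ : Fin m → Δ ℐ) → All (satisfiesAtom (λ i → ⟦ lookup a⃗ i ⟧ⁱ) ρ) ψ

infix 4 _entails_ _⨾_entailsq_

_entails_ : TBox → ELran⊓uInclusion → Set₁
𝒯 entails α = ∀ ℐ → ℐ ⊨ᵀ 𝒯 → ℐ ⊨ α

_⨾_entailsq_ : TBox → ABox → QueryInstance → Set₁
𝒯 ⨾ 𝒜 entailsq q = ∀ ℐ → ℐ ⊨ᵀ 𝒯 → ℐ ⊨ᴬ 𝒜 → ℐ ⊨q q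

Symbol : Set
Symbol = ConceptName ⊎ RoleName

Signature : Set₁
Signature = Pred Symbol 0ℓ

⋃sig : {X : Set} → (X → Signature) → List X → Signature
⋃sig sig xs s = Any (λ x → s ∈ sig x) xs

sigConceptRan : ConceptRan → Signature
sigConceptRan (name A)     = ｛ inj₁ A ｝
sigConceptRan ⊤            = ∅
sigConceptRan (ran r)      = ｛ inj₂ r ｝
sigConceptRan (C ⊓ D)      = sigConceptRan C ∪ sigConceptRan D
sigConceptRan (∃⟨ r ⟩ C)   = ｛ inj₂ r ｝ ∪ sigConceptRan C

sigConcept⊓u : Concept⊓u → Signature
sigConcept⊓u (name A)      = ｛ inj₁ A ｝
sigConcept⊓u ⊤             = ∅
sigConcept⊓u (C ⊓ D)       = sigConcept⊓u C ∪ sigConcept⊓u D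
sigConcept⊓u (∃⟨ R ⟩ C)    = ⋃sig (λ r → ｛ inj₂ r ｝) (toList R) ∪ sigConcept⊓u C
sigConcept⊓u (∃u C)        = sigConcept⊓u C

sigInclusion : ELran⊓uInclusion → Signature
sigInclusion (C ⊑ D)  = sigConceptRan C ∪ sigConcept⊓u D
sigInclusion (r ⊑ʳ s) = ｛ inj₂ r ｝ ∪ ｛ inj₂ s ｝

sigAssertion : Assertion → Signature
sigAssertion (top a)       = ∅
sigAssertion (concept A a) = ｛ inj₁ A ｝
sigAssertion (role r a b)  = ｛ inj₂ r ｝

sigABox : ABox → Signature
sigABox 𝒜 = ⋃sig sigAssertion (toList 𝒜)

sigAtom : ∀ {n m} → Atom n m → Signature
sigAtom (concept A t) = ｛ inj₁ A ｝
sigAtom (role r t t′) = ｛ inj₂ r ｝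

sigQuery : ∀ {n} → ConjunctiveQuery n → Signature
sigQuery (query m ψ) = ⋃sig sigAtom ψ

sigPair : ABox × QueryInstance → Signature
sigPair (𝒜 , q at a⃗) = sigABox 𝒜 ∪ sigQuery q

cDiff : Signature → TBox → TBox → Pred ELran⊓uInclusion (suc 0ℓ)
cDiff Σ 𝒯₁ 𝒯₂ α = sigInclusion α ⊆ Σ × 𝒯₁ entails α × ¬ 𝒯₂ entails α

qDiff : Signature → TBox → TBox → Pred (ABox × QueryInstance) (suc 0ℓ)
qDiff Σ 𝒯₁ 𝒯₂ (𝒜 , q at a⃗) =
    sigABox 𝒜 ⊆ Σ
  × sigQuery q ⊆ Σ
  × Vec.All (_∈ individuals 𝒜) a⃗
  × 𝒯₁ ⨾ 𝒜 entailsq (q at a⃗)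
  × ¬ 𝒯₂ ⨾ 𝒜 entailsq (q at a⃗)

{-# OPTIONS --safe #-}

-- Saturating finitely many facts gives the (tree-shaped) canonical model of a TBox and a finite labelled
-- graph. A match of q in the canonical model of (𝒯₁ , 𝒜) cuts q into trees: a tree hanging from an
-- individual a yields 𝒯₁ ⊨ C ⊑ D, with C an unravelling of 𝒜 at a, a tree disconnected from the
-- individuals yields 𝒯₁ ⊨ C ⊑ ∃u.D, and a query edge between individuals yields 𝒯₁ ⊨ s ⊑ r. If 𝒯₂ entailed
-- all these finitely many inclusions, every model of (𝒯₂ , 𝒜) would match q. To exhibit one that fails
-- constructively, 𝒯₂-entailment of a single inclusion is decided in the canonical model of 𝒯₂ and the
-- syntax tree of C.
module Submission where

open import Defs
open import Level using (Level; 0ℓ)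
open import Data.Bool using (Bool; true; false)
open import Data.Empty using (⊥)
import Data.Unit.Base as Unit
open import Data.Nat using (ℕ; zero; suc; _≤_; _≤′_; ≤′-refl; ≤′-step; _⊔_; _∸_)
import Data.Nat.Properties as ℕ
open import Data.Fin using (Fin)
open import Data.List using (List; []; _∷_; [_]; _++_; map; concatMap; filter; foldr; length; cartesianProduct)
import Data.List.Properties as List
open import Data.List.Extrema.Nat using (max; xs≤max)
open import Data.List.NonEmpty using (_∷_; toList)
open import Data.List.Membership.Propositional using (find; lose) renaming (_∈_ to _∈ˡ_)
open import Data.List.Membership.Propositional.Properties
open import Data.List.Relation.Unary.All as All using (All; []; _∷_)
open import Data.List.Relation.Unary.Any as Any using (Any; here; there; any?)
open import Data.Maybe using (Maybe; just; nothing)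
import Data.Maybe.Properties as Maybe
open import Data.Product using (∃; ∃₂; _×_; _,_; proj₁; proj₂; uncurry)
import Data.Product.Properties as Product
open import Data.Sum using (_⊎_; inj₁; inj₂)
import Data.Sum.Properties as Sum
open import Data.Vec using (Vec; lookup)
open import Function using (_∘_; id)
open import Relation.Nullary using (¬_; Dec; yes; no; contradiction; _×-dec_; _⊎-dec_)
open import Relation.Nullary.Decidable using (map′)
open import Relation.Unary using (Pred; _∈_; _⊆_; Decidable; U)
open import Relation.Binary using (DecidableEquality; _⇒_)
open import Relation.Binary.PropositionalEquality using (_≡_; refl; sym; cong; subst)

open Interpretation

-- The inclusions need, for each individual, a concept over the signature of `𝒜` that forces
-- everything saturation derives there. Left sides of TBox inclusions look forwards along edges, and
-- backwards only through `ran`. A derivation therefore reads a finite tree below the individual,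
-- and an unravelling of finite depth that keeps incoming roles as `ran` records it. No bound on the
-- depth is computed beforehand: it is carried in the invariant of the saturation, which says that
-- every fact is entailed by an unravelling. Two forms of one structure are in play. Its compact
-- form has one node per restriction ∃r.C, so saturation terminates and truth can be evaluated. Its
-- unravelling into paths gives each anonymous element a single predecessor; all query edges into it
-- then share their source, and they become one restriction over a conjunction of roles.

private
  variable
    ℓ : Level
    A B : Set

-- Decidable equality of names and concepts

_≟ᶜⁿ_ : DecidableEquality ConceptName
conceptName m ≟ᶜⁿ conceptName n = map′ (cong conceptName) (cong ConceptName.index) (m ℕ.≟ n)

_≟ʳ_ : DecidableEquality RoleName
roleName m ≟ʳ roleName n = map′ (cong roleName) (cong RoleName.index) (m ℕ.≟ n)

_≟ⁱ_ : DecidableEquality IndName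
indName m ≟ⁱ indName n = map′ (cong indName) (cong IndName.index) (m ℕ.≟ n)

_≟ᶜ_ : DecidableEquality Concept
name A     ≟ᶜ name B     = map′ (cong name) (λ { refl → refl }) (A ≟ᶜⁿ B)
name _     ≟ᶜ ⊤          = no λ ()
name _     ≟ᶜ (_ ⊓ _)    = no λ ()
name _     ≟ᶜ (∃⟨ _ ⟩ _) = no λ ()
⊤          ≟ᶜ name _     = no λ ()
⊤          ≟ᶜ ⊤          = yes refl
⊤          ≟ᶜ (_ ⊓ _)    = no λ ()
⊤          ≟ᶜ (∃⟨ _ ⟩ _) = no λ ()
(_ ⊓ _)    ≟ᶜ name _     = no λ ()
(_ ⊓ _)    ≟ᶜ ⊤          = no λ ()
(C ⊓ D)    ≟ᶜ (C′ ⊓ D′)  = map′ (λ { (refl , refl) → refl }) (λ { refl → refl , refl }) (C ≟ᶜ C′ ×-dec D ≟ᶜ D′)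
(_ ⊓ _)    ≟ᶜ (∃⟨ _ ⟩ _) = no λ ()
(∃⟨ _ ⟩ _) ≟ᶜ name _     = no λ ()
(∃⟨ _ ⟩ _) ≟ᶜ ⊤          = no λ ()
(∃⟨ _ ⟩ _) ≟ᶜ (_ ⊓ _)    = no λ ()
(∃⟨ r ⟩ C) ≟ᶜ (∃⟨ s ⟩ D) = map′ (λ { (refl , refl) → refl }) (λ { refl → refl , refl }) (r ≟ʳ s ×-dec C ≟ᶜ D)

_≟ᵉ_ : DecidableEquality (RoleName × Concept)
_≟ᵉ_ = Product.≡-dec _≟ʳ_ _≟ᶜ_

open import Data.List.Membership.DecPropositional _≟ʳ_ using () renaming (_∈?_ to _∈ʳ?_)
open import Data.List.Membership.DecPropositional _≟ᶜⁿ_ using () renaming (_∈?_ to _∈ᶜⁿ?_)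

-- Saturation inside a finite universe

module _ (Φ : List A → Pred A 0ℓ) (Φ? : ∀ S → Decidable (Φ S))
         (Inv : Pred (List A) ℓ) (extend : ∀ {S x} → Inv S → Φ S x → Inv (x ∷ S)) where

  private
    Saturation : List A → List A → Set _
    Saturation S U = ∃ λ S′ → Inv S′ × (∀ {x} → x ∈ˡ S → x ∈ˡ S′) × (∀ {x} → x ∈ˡ U → Φ S′ x → x ∈ˡ S′)

    -- Each round moves one entry of `U` into `S`, so the length of `U` bounds the rounds. Closure
    -- concerns the final list alone: an entry that was moved lies in `S′`, and one that remains
    -- fails `Φ S′`.
    saturateWithin : ∀ n S U → length U ≤ n → Inv S → Saturation S U
    saturateWithin zero    S [] _   inv = S , inv , id , λ ()
    saturateWithin (suc n) S U  U≤n inv with any? (Φ? S) U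
    ... | no none = S , inv , id , λ x∈U φ → contradiction (lose x∈U φ) none
    ... | yes some with find some
    ...   | x , x∈U , φ with ∈-∃++ x∈U
    ...     | ys , zs , refl with saturateWithin n (x ∷ S) (ys ++ zs) (ℕ.≤-pred (subst (_≤ suc n) (List.length-++-sucʳ ys x zs) U≤n)) (extend inv φ)
    ...       | S′ , inv′ , S⊆S′ , closed = S′ , inv′ , S⊆S′ ∘ there , λ y∈U → close (∈-++⁻ ys y∈U)
      where
      close : ∀ {y} → y ∈ˡ ys ⊎ y ∈ˡ x ∷ zs → Φ S′ y → y ∈ˡ S′
      close (inj₁ y∈ys)         = closed (∈-++⁺ˡ y∈ys)
      close (inj₂ (here refl))  = λ _ → S⊆S′ (here refl)
      close (inj₂ (there y∈zs)) = closed (∈-++⁺ʳ ys y∈zs)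

  saturate : ∀ S U → Inv S → Saturation S U
  saturate S U = saturateWithin (length U) S U ℕ.≤-refl

-- Uniform format for the inclusions of a TBox

-- (rs , C , D) stands for the inclusion ran(r₁) ⊓ ⋯ ⊓ ran(rₙ) ⊓ C ⊑ D.
GCI : Set
GCI = List RoleName × Concept × Concept

gcis : ELHrInclusion → List GCI
gcis (C ⊑ D)           = [ [] , C , D ]
gcis (ran⟨ r ⟩⊑ D)     = [ [ r ] , ⊤ , D ]
gcis (ran⟨ r ⟩⊓ C ⊑ D) = [ [ r ] , C , D ]
gcis (C ≡ᶜ D)          = ([] , C , D) ∷ ([] , D , C) ∷ []
gcis (r ⊑ʳ s)          = []

roleInclusions : ELHrInclusion → List (RoleName × RoleName)
roleInclusions (r ⊑ʳ s) = [ r , s ]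
roleInclusions _        = []

SatisfiesGCI : Interpretation → GCI → Set
SatisfiesGCI ℐ (rs , C , D) = ∀ {d} → All (λ r → ⟦ran_⟧ ℐ r d) rs → ⟦_⟧ ℐ C d → ⟦_⟧ ℐ D d

SatisfiesRole : Interpretation → RoleName × RoleName → Set
SatisfiesRole ℐ (r , s) = ⟦_⟧ʳ ℐ r ⇒ ⟦_⟧ʳ ℐ s

satisfies⁺ : ∀ ℐ α → All (SatisfiesGCI ℐ) (gcis α) → All (SatisfiesRole ℐ) (roleInclusions α) → satisfiesELHr ℐ α
satisfies⁺ ℐ (C ⊑ D)           (h ∷ [])     _        = h []
satisfies⁺ ℐ (ran⟨ r ⟩⊑ D)     (h ∷ [])     _        = λ x → h (x ∷ []) _
satisfies⁺ ℐ (ran⟨ r ⟩⊓ C ⊑ D) (h ∷ [])     _        = λ (x , c) → h (x ∷ []) c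
satisfies⁺ ℐ (C ≡ᶜ D)          (h ∷ g ∷ []) _        = h [] , g []
satisfies⁺ ℐ (r ⊑ʳ s)          _            (h ∷ []) = h

satisfies⁻ : ∀ ℐ α → satisfiesELHr ℐ α → All (SatisfiesGCI ℐ) (gcis α) × All (SatisfiesRole ℐ) (roleInclusions α)
satisfies⁻ ℐ (C ⊑ D)           h       = (λ _ → h) ∷ [] , []
satisfies⁻ ℐ (ran⟨ r ⟩⊑ D)     h       = (λ { (x ∷ []) _ → h x }) ∷ [] , []
satisfies⁻ ℐ (ran⟨ r ⟩⊓ C ⊑ D) h       = (λ { (x ∷ []) c → h (x , c) }) ∷ [] , []
satisfies⁻ ℐ (C ≡ᶜ D)          (h , g) = (λ _ → h) ∷ (λ _ → g) ∷ [] , []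
satisfies⁻ ℐ (r ⊑ʳ s)          h       = [] , h ∷ []

module _ {ℐ : Interpretation} where

  ⊨ᵀ⁺ : ∀ {𝒯} → (∀ {g} → g ∈ˡ concatMap gcis 𝒯 → SatisfiesGCI ℐ g) →
        (∀ {p} → p ∈ˡ concatMap roleInclusions 𝒯 → SatisfiesRole ℐ p) → ℐ ⊨ᵀ 𝒯
  ⊨ᵀ⁺ hg hr = All.tabulate λ {α} α∈𝒯 → satisfies⁺ ℐ α
    (All.tabulate λ g∈ → hg (∈-concatMap⁺ gcis (lose α∈𝒯 g∈)))
    (All.tabulate λ p∈ → hr (∈-concatMap⁺ roleInclusions (lose α∈𝒯 p∈)))

  ⊨ᵀ-gci : ∀ {𝒯 g} → ℐ ⊨ᵀ 𝒯 → g ∈ˡ concatMap gcis 𝒯 → SatisfiesGCI ℐ g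
  ⊨ᵀ-gci ℐ⊨𝒯 g∈ with find (∈-concatMap⁻ gcis g∈)
  ... | α , α∈𝒯 , g∈α = All.lookup (proj₁ (satisfies⁻ ℐ α (All.lookup ℐ⊨𝒯 α∈𝒯))) g∈α

  ⊨ᵀ-role : ∀ {𝒯 p} → ℐ ⊨ᵀ 𝒯 → p ∈ˡ concatMap roleInclusions 𝒯 → SatisfiesRole ℐ p
  ⊨ᵀ-role ℐ⊨𝒯 p∈ with find (∈-concatMap⁻ roleInclusions p∈)
  ... | α , α∈𝒯 , p∈α = All.lookup (proj₂ (satisfies⁻ ℐ α (All.lookup ℐ⊨𝒯 α∈𝒯))) p∈α

-- The role hierarchy

module Roles (𝒯 : TBox) (r : RoleName) where

  private
    Super : List RoleName → Pred RoleName 0ℓ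
    Super S t = Any (λ p → proj₁ p ∈ˡ S × t ≡ proj₂ p) (concatMap roleInclusions 𝒯)

    Inv : Pred (List RoleName) _
    Inv = All λ s → ∀ ℐ → ℐ ⊨ᵀ 𝒯 → SatisfiesRole ℐ (r , s)

    extend : ∀ {S t} → Inv S → Super S t → Inv (t ∷ S)
    extend inv super with find super
    ... | (s , t) , p∈ , s∈S , refl =
      (λ ℐ ℐ⊨𝒯 → ⊨ᵀ-role ℐ⊨𝒯 p∈ ∘ All.lookup inv s∈S ℐ ℐ⊨𝒯) ∷ inv

    saturation = saturate Super (λ S t → any? (λ p → proj₁ p ∈ʳ? S ×-dec t ≟ʳ proj₂ p) _) Inv extend
      [ r ] (map proj₂ (concatMap roleInclusions 𝒯)) ((λ _ _ → id) ∷ [])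

  abstract
    supers : List RoleName
    supers = proj₁ saturation

    supers-sound : ∀ {s} → s ∈ˡ supers → ∀ ℐ → ℐ ⊨ᵀ 𝒯 → ⟦_⟧ʳ ℐ r ⇒ ⟦_⟧ʳ ℐ s
    supers-sound = All.lookup (proj₁ (proj₂ saturation))

    supers-refl : r ∈ˡ supers
    supers-refl = proj₁ (proj₂ (proj₂ saturation)) (here refl)

    supers-step : ∀ {s t} → s ∈ˡ supers → (s , t) ∈ˡ concatMap roleInclusions 𝒯 → t ∈ˡ supers
    supers-step s∈ p∈ = proj₂ (proj₂ (proj₂ saturation)) (∈-map⁺ proj₂ p∈) (lose p∈ (s∈ , refl))

open Roles using (supers; supers-sound; supers-refl; supers-step)

-- Conjuncts and restrictions of concepts

names : Concept → List ConceptName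
names (name A)   = [ A ]
names ⊤          = []
names (C ⊓ D)    = names C ++ names D
names (∃⟨ r ⟩ C) = []

exs : Concept → List (RoleName × Concept)
exs (name A)   = []
exs ⊤          = []
exs (C ⊓ D)    = exs C ++ exs D
exs (∃⟨ r ⟩ C) = [ r , C ]

nestedExs : Concept → List (RoleName × Concept)
nestedExs (name A)   = []
nestedExs ⊤          = []
nestedExs (C ⊓ D)    = nestedExs C ++ nestedExs D
nestedExs (∃⟨ r ⟩ C) = (r , C) ∷ nestedExs C

exs⊆nestedExs : ∀ C {e} → e ∈ˡ exs C → e ∈ˡ nestedExs C
exs⊆nestedExs (C ⊓ D) e∈ with ∈-++⁻ (exs C) e∈
... | inj₁ e∈C = ∈-++⁺ˡ (exs⊆nestedExs C e∈C)
... | inj₂ e∈D = ∈-++⁺ʳ (nestedExs C) (exs⊆nestedExs D e∈D)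
exs⊆nestedExs (∃⟨ r ⟩ C) (here refl) = here refl

-- The node for ∃r.D is told `D`, so the restrictions of `D` must have nodes in the same finite
-- stock.
nestedExs-closed : ∀ C {r D e} → (r , D) ∈ˡ nestedExs C → e ∈ˡ exs D → e ∈ˡ nestedExs C
nestedExs-closed (C ⊓ D) f∈ e∈ with ∈-++⁻ (nestedExs C) f∈
... | inj₁ f∈C = ∈-++⁺ˡ (nestedExs-closed C f∈C e∈)
... | inj₂ f∈D = ∈-++⁺ʳ (nestedExs C) (nestedExs-closed D f∈D e∈)
nestedExs-closed (∃⟨ r ⟩ C) (here refl) e∈ = there (exs⊆nestedExs C e∈)
nestedExs-closed (∃⟨ r ⟩ C) (there f∈)  e∈ = there (nestedExs-closed C f∈ e∈)

module _ (ℐ : Interpretation) where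

  names-sound : ∀ C {A d} → A ∈ˡ names C → ⟦_⟧ ℐ C d → ⟦_⟧ᴬ ℐ A d
  names-sound (name A) (here refl) d∈ = d∈
  names-sound (C ⊓ D)  A∈ (d∈C , d∈D) with ∈-++⁻ (names C) A∈
  ... | inj₁ A∈C = names-sound C A∈C d∈C
  ... | inj₂ A∈D = names-sound D A∈D d∈D

  exs-sound : ∀ C {r D d} → (r , D) ∈ˡ exs C → ⟦_⟧ ℐ C d → ⟦_⟧ ℐ (∃⟨ r ⟩ D) d
  exs-sound (∃⟨ r ⟩ C) (here refl) d∈ = d∈
  exs-sound (C ⊓ D)    e∈ (d∈C , d∈D) with ∈-++⁻ (exs C) e∈
  ... | inj₁ e∈C = exs-sound C e∈C d∈C
  ... | inj₂ e∈D = exs-sound D e∈D d∈D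

⨅ : List ConceptRan → ConceptRan
⨅ = foldr _⊓_ ⊤

module _ (ℐ : Interpretation) {d : Δ ℐ} where

  ⨅⁺ : ∀ Cs → (∀ {C} → C ∈ˡ Cs → ⟦_⟧ran ℐ C d) → ⟦_⟧ran ℐ (⨅ Cs) d
  ⨅⁺ []       h = _
  ⨅⁺ (C ∷ Cs) h = h (here refl) , ⨅⁺ Cs (h ∘ there)

  ⨅⁻ : ∀ Cs → ⟦_⟧ran ℐ (⨅ Cs) d → ∀ {C} → C ∈ˡ Cs → ⟦_⟧ran ℐ C d
  ⨅⁻ (C ∷ Cs) (x , _)  (here refl) = x
  ⨅⁻ (C ∷ Cs) (_ , xs) (there C∈)  = ⨅⁻ Cs xs C∈

sig-⨅ : ∀ Cs {σ : Signature} → (∀ {C} → C ∈ˡ Cs → sigConceptRan C ⊆ σ) → sigConceptRan (⨅ Cs) ⊆ σ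
sig-⨅ (C ∷ Cs) h (inj₁ s∈C)  = h (here refl) s∈C
sig-⨅ (C ∷ Cs) h (inj₂ s∈Cs) = sig-⨅ Cs (h ∘ there) s∈Cs

-- Labelled graphs and their unravelling into concepts

record Graph (V : Set) : Set where
  constructor graph
  field
    labels : List (ConceptName × V)
    edges  : List (RoleName × V × V)

record Homomorphism {V : Set} (𝒢 : Graph V) (ℐ : Interpretation) (h : V → Δ ℐ) : Set where
  open Graph 𝒢
  field
    label : ∀ {A v} → (A , v) ∈ˡ labels → ⟦_⟧ᴬ ℐ A (h v)
    edge  : ∀ {r v w} → (r , v , w) ∈ˡ edges → ⟦_⟧ʳ ℐ r (h v) (h w)

module Unravelling {V : Set} (_≟_ : DecidableEquality V) (𝒢 : Graph V) where
  open Graph 𝒢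

  localNames localRans : V → List ConceptRan
  localNames v = map (name ∘ proj₁) (filter ((v ≟_) ∘ proj₂) labels)
  localRans  v = map (ran ∘ proj₁) (filter ((v ≟_) ∘ proj₂ ∘ proj₂) edges)

  edgeConcept : (V → ConceptRan) → RoleName × V × V → ConceptRan
  edgeConcept C (r , _ , w) = ∃⟨ r ⟩ C w

  edgeConcepts : (V → ConceptRan) → V → List ConceptRan
  edgeConcepts C v = map (edgeConcept C) (filter ((v ≟_) ∘ proj₁ ∘ proj₂) edges)

  localNames⁻ : ∀ v {C} → C ∈ˡ localNames v → ∃ λ A → (A , v) ∈ˡ labels × C ≡ name A
  localNames⁻ v C∈ with ∈-map∘filter⁻ (name ∘ proj₁) ((v ≟_) ∘ proj₂) {xs = labels} C∈
  ... | (A , _) , A∈ , refl , refl = A , A∈ , refl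

  localRans⁻ : ∀ v {C} → C ∈ˡ localRans v → ∃₂ λ r u → (r , u , v) ∈ˡ edges × C ≡ ran r
  localRans⁻ v C∈ with ∈-map∘filter⁻ (ran ∘ proj₁) ((v ≟_) ∘ proj₂ ∘ proj₂) {xs = edges} C∈
  ... | (r , u , _) , r∈ , refl , refl = r , u , r∈ , refl

  edgeConcepts⁻ : ∀ {D} v {C} → C ∈ˡ edgeConcepts D v → ∃₂ λ r w → (r , v , w) ∈ˡ edges × C ≡ ∃⟨ r ⟩ D w
  edgeConcepts⁻ {D} v C∈ with ∈-map∘filter⁻ (edgeConcept D) ((v ≟_) ∘ proj₁ ∘ proj₂) {xs = edges} C∈
  ... | (r , _ , w) , r∈ , refl , refl = r , w , r∈ , refl

  -- Incoming edges survive only as ran: 𝒞ran-concepts have no inverse roles.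
  unravel children : ℕ → V → ConceptRan
  unravel n v = ⨅ (localNames v) ⊓ ⨅ (localRans v) ⊓ children n v
  children zero    v = ⊤
  children (suc n) v = ⨅ (edgeConcepts (unravel n) v)

  module _ (ℐ : Interpretation) where

    unravel-label : ∀ n {A v d} → (A , v) ∈ˡ labels → ⟦_⟧ran ℐ (unravel n v) d → ⟦_⟧ᴬ ℐ A d
    unravel-label n {v = v} A∈ (d∈ , _) =
      ⨅⁻ ℐ (localNames v) d∈ (∈-map∘filter⁺ (name ∘ proj₁) ((v ≟_) ∘ proj₂) (_ , A∈ , refl , refl))

    unravel-ran : ∀ n {r u v d} → (r , u , v) ∈ˡ edges → ⟦_⟧ran ℐ (unravel n v) d → ⟦ran_⟧ ℐ r d
    unravel-ran n {v = v} r∈ (_ , d∈ , _) =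
      ⨅⁻ ℐ (localRans v) d∈ (∈-map∘filter⁺ (ran ∘ proj₁) ((v ≟_) ∘ proj₂ ∘ proj₂) (_ , r∈ , refl , refl))

    unravel-edge : ∀ n {r v w d} → (r , v , w) ∈ˡ edges → ⟦_⟧ran ℐ (unravel (suc n) v) d →
                   ⟦_⟧ran ℐ (∃⟨ r ⟩ unravel n w) d
    unravel-edge n {v = v} r∈ (_ , _ , d∈) =
      ⨅⁻ ℐ (edgeConcepts (unravel n) v) d∈ (∈-map∘filter⁺ (edgeConcept (unravel n)) ((v ≟_) ∘ proj₁ ∘ proj₂) (_ , r∈ , refl , refl))

    unravel-pred : ∀ n v {d} → ⟦_⟧ran ℐ (unravel (suc n) v) d → ⟦_⟧ran ℐ (unravel n v) d
    unravel-pred zero    v (a , b , _) = a , b , _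
    unravel-pred (suc n) v d∈@(a , b , _) = a , b , ⨅⁺ ℐ (edgeConcepts (unravel n) v) step
      where
      step : ∀ {C} → C ∈ˡ edgeConcepts (unravel n) v → ⟦_⟧ran ℐ C _
      step C∈ with edgeConcepts⁻ v C∈
      ... | r , w , r∈ , refl with unravel-edge (suc n) r∈ d∈
      ...   | e , rde , e∈ = e , rde , unravel-pred n w e∈

    unravel-antitone : ∀ {m n} → m ≤ n → ∀ v {d} → ⟦_⟧ran ℐ (unravel n v) d → ⟦_⟧ran ℐ (unravel m v) d
    unravel-antitone {m} {n} m≤n v = go (ℕ.≤⇒≤′ m≤n)
      where
      go : ∀ {n} → m ≤′ n → ∀ {d} → ⟦_⟧ran ℐ (unravel n v) d → ⟦_⟧ran ℐ (unravel m v) d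
      go ≤′-refl       d∈ = d∈
      go (≤′-step {n = k} m≤n) d∈ = go m≤n (unravel-pred k v d∈)

    module _ {h : V → Δ ℐ} (hom : Homomorphism 𝒢 ℐ h) where
      open Homomorphism hom

      -- Cycles in the graph do no harm: the images of its vertices serve as successors again, up to
      -- any depth.
      hom-unravel : ∀ n v → ⟦_⟧ran ℐ (unravel n v) (h v)
      hom-children : ∀ n v → ⟦_⟧ran ℐ (children n v) (h v)
      hom-unravel n v = ⨅⁺ ℐ (localNames v) nameStep , ⨅⁺ ℐ (localRans v) ranStep , hom-children n v
        where
        nameStep : ∀ {C} → C ∈ˡ localNames v → ⟦_⟧ran ℐ C (h v)
        nameStep C∈ with localNames⁻ v C∈
        ... | _ , A∈ , refl = label A∈
        ranStep : ∀ {C} → C ∈ˡ localRans v → ⟦_⟧ran ℐ C (h v)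
        ranStep C∈ with localRans⁻ v C∈
        ... | _ , _ , r∈ , refl = _ , edge r∈
      hom-children zero    v = _
      hom-children (suc n) v = ⨅⁺ ℐ (edgeConcepts (unravel n) v) step
        where
        step : ∀ {C} → C ∈ˡ edgeConcepts (unravel n) v → ⟦_⟧ran ℐ C (h v)
        step C∈ with edgeConcepts⁻ v C∈
        ... | r , w , r∈ , refl = h w , edge r∈ , hom-unravel n w

  module _ {σ : Signature} (σ-label : ∀ {A v} → (A , v) ∈ˡ labels → σ (inj₁ A))
           (σ-edge : ∀ {r e} → (r , e) ∈ˡ edges → σ (inj₂ r)) where

    sig-unravel : ∀ n v → sigConceptRan (unravel n v) ⊆ σ
    sig-children : ∀ n v → sigConceptRan (children n v) ⊆ σ
    sig-unravel n v (inj₁ s∈) = sig-⨅ (localNames v) step s∈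
      where
      step : ∀ {C} → C ∈ˡ localNames v → sigConceptRan C ⊆ σ
      step C∈ with localNames⁻ v C∈
      ... | _ , A∈ , refl = λ { refl → σ-label A∈ }
    sig-unravel n v (inj₂ (inj₁ s∈)) = sig-⨅ (localRans v) step s∈
      where
      step : ∀ {C} → C ∈ˡ localRans v → sigConceptRan C ⊆ σ
      step C∈ with localRans⁻ v C∈
      ... | _ , _ , r∈ , refl = λ { refl → σ-edge r∈ }
    sig-unravel n v (inj₂ (inj₂ s∈)) = sig-children n v s∈
    sig-children (suc n) v = sig-⨅ (edgeConcepts (unravel n) v) step
      where
      step : ∀ {C} → C ∈ˡ edgeConcepts (unravel n) v → sigConceptRan C ⊆ σ
      step C∈ with edgeConcepts⁻ v C∈
      ... | r , w , r∈ , refl = λ { (inj₁ refl) → σ-edge r∈ ; (inj₂ s∈) → sig-unravel n w s∈ }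

-- The canonical model of a TBox and a graph

module Canonical (𝒯 : TBox) {V : Set} (_≟_ : DecidableEquality V) (𝒢 : Graph V) (nodes : List V) where
  open Graph 𝒢
  open Unravelling _≟_ 𝒢

  private
    allGCIs : List GCI
    allGCIs = concatMap gcis 𝒯

    heads : List Concept
    heads = map (proj₂ ∘ proj₂) allGCIs

    -- Graph labels are concept names, so restrictions are enforced by heads alone; their nested
    -- restrictions are all the witnesses that can arise.
    allExs : List (RoleName × Concept)
    allExs = concatMap nestedExs heads

  -- wit (r , C) represents the witnesses of the restriction ∃r.C, wherever it is enforced.
  data Node : Set where
    ind : V → Node
    wit : RoleName × Concept → Node

  _≟ᴺ_ : DecidableEquality Node
  ind v ≟ᴺ ind w = map′ (cong ind) (λ { refl → refl }) (v ≟ w)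
  ind _ ≟ᴺ wit _ = no λ ()
  wit _ ≟ᴺ ind _ = no λ ()
  wit e ≟ᴺ wit f = map′ (cong wit) (λ { refl → refl }) (e ≟ᵉ f)

  allNodes : List Node
  allNodes = map ind nodes ++ map wit allExs

  BaseEdge : RoleName → V → V → Set
  BaseEdge s v w = Any (λ e → proj₂ e ≡ (v , w) × s ∈ˡ supers 𝒯 (proj₁ e)) edges

  BaseEdge? : ∀ s v w → Dec (BaseEdge s v w)
  BaseEdge? s v w = any? (λ e → Product.≡-dec _≟_ _≟_ (proj₂ e) (v , w) ×-dec s ∈ʳ? supers 𝒯 (proj₁ e)) edges

  EdgeTo : RoleName → Node → V → Set
  EdgeTo s (ind v) w = BaseEdge s v w
  EdgeTo s (wit _) w = ⊥

  EdgeTo? : ∀ s x w → Dec (EdgeTo s x w)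
  EdgeTo? s (ind v) w = BaseEdge? s v w
  EdgeTo? s (wit _) w = no λ ()

  HasRan : RoleName → Node → Set
  HasRan s (ind v)       = Any (λ u → BaseEdge s u v) nodes
  HasRan s (wit (r , _)) = s ∈ˡ supers 𝒯 r

  HasRan? : ∀ s x → Dec (HasRan s x)
  HasRan? s (ind v)       = any? (λ u → BaseEdge? s u v) nodes
  HasRan? s (wit (r , _)) = s ∈ʳ? supers 𝒯 r

  -- What the unravelling of depth n makes true of the elements represented by a node.
  Described : ℕ → Node → (ℐ : Interpretation) → Pred (Δ ℐ) 0ℓ
  Described n (ind v)       ℐ d = ⟦_⟧ran ℐ (unravel n v) d
  Described n (wit (r , C)) ℐ d = ⟦ran_⟧ ℐ r d × ⟦_⟧ ℐ C d

  Described-antitone : ∀ {m n} → m ≤ n → ∀ x {ℐ} → Described n x ℐ ⊆ Described m x ℐ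
  Described-antitone m≤n (ind v) {ℐ} = unravel-antitone ℐ m≤n v
  Described-antitone m≤n (wit _) d∈  = d∈

  Sound : ℕ → Node → Concept → Set₁
  Sound n x C = ∀ ℐ → ℐ ⊨ᵀ 𝒯 → Described n x ℐ ⊆ ⟦_⟧ ℐ C

  Sound-mono : ∀ {m n x C} → m ≤ n → Sound m x C → Sound n x C
  Sound-mono {x = x} m≤n sound ℐ ℐ⊨𝒯 = sound ℐ ℐ⊨𝒯 ∘ Described-antitone m≤n x

  BaseEdge-sound : ∀ {s v w} → BaseEdge s v w → ∃ λ r → (r , v , w) ∈ˡ edges × s ∈ˡ supers 𝒯 r
  BaseEdge-sound b with find b
  ... | _ , r∈ , refl , s∈ = _ , r∈ , s∈

  HasRan-sound : ∀ {s} x → HasRan s x → ∀ n ℐ → ℐ ⊨ᵀ 𝒯 → Described n x ℐ ⊆ ⟦ran_⟧ ℐ s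
  HasRan-sound (wit (r , _)) s∈ n ℐ ℐ⊨𝒯 ((e , red) , _) = e , supers-sound 𝒯 r s∈ ℐ ℐ⊨𝒯 red
  HasRan-sound (ind v) b n ℐ ℐ⊨𝒯 d∈ with find b
  ... | u , _ , b′ with BaseEdge-sound b′
  ...   | r , r∈ , s∈ with unravel-ran ℐ n r∈ d∈
  ...     | e , red = e , supers-sound 𝒯 r s∈ ℐ ℐ⊨𝒯 red

  -- A member (x , D) says that the elements represented by x are instances of D.
  State : Set
  State = List (Node × Concept)

  module _ (S : State) where

    told : (Concept → List B) → Node → List B
    told f x = concatMap (f ∘ proj₂) (filter ((x ≟ᴺ_) ∘ proj₁) S)

    -- Truth in the compact structure that `S` describes. The recursion is on the concept only, so
    -- cycles among witnesses do not endanger decidability.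
    Holds : Concept → Pred Node 0ℓ
    Holds (name A)   x = A ∈ˡ told names x
    Holds ⊤          x = Unit.⊤
    Holds (C ⊓ D)    x = Holds C x × Holds D x
    Holds (∃⟨ s ⟩ C) x = Any (λ e → s ∈ˡ supers 𝒯 (proj₁ e) × Holds C (wit e)) (told exs x)
                       ⊎ Any (λ w → EdgeTo s x w × Holds C (ind w)) nodes

    Holds? : ∀ C x → Dec (Holds C x)
    Holds? (name A)   x = A ∈ᶜⁿ? told names x
    Holds? ⊤          x = yes _
    Holds? (C ⊓ D)    x = Holds? C x ×-dec Holds? D x
    Holds? (∃⟨ s ⟩ C) x = any? (λ e → s ∈ʳ? supers 𝒯 (proj₁ e) ×-dec Holds? C (wit e)) (told exs x)
                      ⊎-dec any? (λ w → EdgeTo? s x w ×-dec Holds? C (ind w)) nodes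

    Fires : Node × Concept → GCI → Set
    Fires (x , D) (rs , C , D′) = D ≡ D′ × All (λ r → HasRan r x) rs × Holds C x

    Step : Pred (Node × Concept) 0ℓ
    Step f = Any (Fires f) allGCIs

    Step? : Decidable Step
    Step? (x , D) = any? (λ { (rs , C , D′) → D ≟ᶜ D′ ×-dec All.all? (λ r → HasRan? r x) rs ×-dec Holds? C x }) allGCIs

  told⁺ : ∀ {S} (f : Concept → List B) {x D b} → (x , D) ∈ˡ S → b ∈ˡ f D → b ∈ˡ told S f x
  told⁺ {S = S} f {x} D∈ b∈ =
    ∈-concatMap⁺ (f ∘ proj₂) (lose (∈-filter⁺ ((x ≟ᴺ_) ∘ proj₁) D∈ refl) b∈)

  told⁻ : ∀ {S} (f : Concept → List B) {x b} → b ∈ˡ told S f x → ∃ λ D → (x , D) ∈ˡ S × b ∈ˡ f D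
  told⁻ {S = S} f {x} b∈ with find (∈-concatMap⁻ (f ∘ proj₂) b∈)
  ... | (_ , D) , y∈ , b∈D with ∈-filter⁻ ((x ≟ᴺ_) ∘ proj₁) {xs = S} y∈
  ...   | D∈ , refl = D , D∈ , b∈D

  -- The depth is existential because a derivation along a graph edge costs one more layer of the
  -- unravelling, and how often this happens is known only when saturation ends.
  Inv : Pred State _
  Inv S = ∃ λ n → ∀ {x D} → (x , D) ∈ˡ S → (∀ {e} → e ∈ˡ exs D → e ∈ˡ allExs) × Sound n x D

  Holds-sound : ∀ {S} → Inv S → ∀ C x → Holds S C x → ∃ λ n → Sound n x C
  Holds-sound (n , inv) (name A) x A∈ with told⁻ names A∈
  ... | D , D∈ , A∈D = n , λ ℐ ℐ⊨𝒯 → names-sound ℐ D A∈D ∘ proj₂ (inv D∈) ℐ ℐ⊨𝒯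
  Holds-sound inv ⊤ x _ = 0 , _
  Holds-sound inv (C ⊓ D) x (c , d) with Holds-sound inv C x c | Holds-sound inv D x d
  ... | m , sc | n , sd = m ⊔ n , λ ℐ ℐ⊨𝒯 d∈ →
    Sound-mono {x = x} {C} (ℕ.m≤m⊔n m n) sc ℐ ℐ⊨𝒯 d∈ , Sound-mono {x = x} {D} (ℕ.m≤n⊔m m n) sd ℐ ℐ⊨𝒯 d∈
  Holds-sound (n , inv) (∃⟨ s ⟩ C) x (inj₁ a) with find a
  ... | (r , E) , e∈ , s∈ , c with told⁻ exs e∈ | Holds-sound (n , inv) C (wit (r , E)) c
  ...   | D , D∈ , e∈D | _ , sc = n , sound
    where
    sound : Sound n x (∃⟨ s ⟩ C)
    sound ℐ ℐ⊨𝒯 d∈ with exs-sound ℐ D e∈D (proj₂ (inv D∈) ℐ ℐ⊨𝒯 d∈)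
    ... | d′ , rdd′ , d′∈ = d′ , supers-sound 𝒯 r s∈ ℐ ℐ⊨𝒯 rdd′ , sc ℐ ℐ⊨𝒯 ((_ , rdd′) , d′∈)
  Holds-sound inv (∃⟨ s ⟩ C) (ind v) (inj₂ a) with find a
  ... | w , _ , b , c with BaseEdge-sound b | Holds-sound inv C (ind w) c
  ...   | r , r∈ , s∈ | n , sc = suc n , sound
    where
    sound : Sound (suc n) (ind v) (∃⟨ s ⟩ C)
    sound ℐ ℐ⊨𝒯 d∈ with unravel-edge ℐ n r∈ d∈
    ... | d′ , rdd′ , d′∈ = d′ , supers-sound 𝒯 r s∈ ℐ ℐ⊨𝒯 rdd′ , sc ℐ ℐ⊨𝒯 d′∈
  Holds-sound inv (∃⟨ s ⟩ C) (wit _) (inj₂ a) with find a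
  ... | _ , _ , () , _

  private
    head∈ : ∀ {rs C D} → (rs , C , D) ∈ˡ allGCIs → ∀ {e} → e ∈ˡ nestedExs D → e ∈ˡ allExs
    head∈ g∈ e∈ = ∈-concatMap⁺ nestedExs (lose (∈-map⁺ (proj₂ ∘ proj₂) g∈) e∈)

    extend : ∀ {S f} → Inv S → Step S f → Inv (f ∷ S)
    extend {S} {x , D} (n , inv) step with find step
    ... | (rs , C , _) , g∈ , refl , hrs , c with Holds-sound (n , inv) C x c
    ...   | m , sc = m ⊔ n , λ
      { (here refl) → head∈ g∈ ∘ exs⊆nestedExs D , λ ℐ ℐ⊨𝒯 d∈ → ⊨ᵀ-gci ℐ⊨𝒯 g∈
          (All.map (λ h → HasRan-sound x h (m ⊔ n) ℐ ℐ⊨𝒯 d∈) hrs)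
          (Sound-mono {x = x} {C} (ℕ.m≤m⊔n m n) sc ℐ ℐ⊨𝒯 d∈)
      ; {y} {E} (there f∈) → proj₁ (inv f∈) , Sound-mono {n} {m ⊔ n} {y} {E} (ℕ.m≤n⊔m m n) (proj₂ (inv f∈)) }

    initialLabel : ConceptName × V → Node × Concept
    initialLabel (A , v) = ind v , name A

    initialWitness : RoleName × Concept → Node × Concept
    initialWitness e = wit e , proj₂ e

    initial : State
    initial = map initialLabel labels ++ map initialWitness allExs

    initial-inv : Inv initial
    initial-inv = 0 , split
      where
      split : ∀ {x D} → (x , D) ∈ˡ initial → (∀ {e} → e ∈ˡ exs D → e ∈ˡ allExs) × Sound 0 x D
      split f∈ with ∈-++⁻ (map initialLabel labels) f∈
      split f∈ | inj₁ l∈ with ∈-map⁻ initialLabel l∈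
      ... | _ , A∈ , refl = (λ ()) , λ ℐ _ → unravel-label ℐ 0 A∈
      split f∈ | inj₂ w∈ with ∈-map⁻ initialWitness w∈
      ... | (r , C) , e∈ , refl with find (∈-concatMap⁻ nestedExs {xs = heads} e∈)
      ...   | H , H∈ , e∈H = (λ f∈ → ∈-concatMap⁺ nestedExs (lose H∈ (nestedExs-closed H e∈H f∈))) , λ _ _ → proj₂

    -- A rule only ever adds a head, and `allNodes` contains the tail of every path, so this product
    -- is a large enough universe.
    saturation = saturate Step Step? Inv extend initial (cartesianProduct allNodes heads) initial-inv

  abstract
    facts : State
    facts = proj₁ saturation

    depth : ℕ
    depth = proj₁ (proj₁ (proj₂ saturation))

    facts-sound : ∀ {x D} → (x , D) ∈ˡ facts → Sound depth x D
    facts-sound = proj₂ ∘ proj₂ (proj₁ (proj₂ saturation))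

    facts-exs : ∀ {x D e} → (x , D) ∈ˡ facts → e ∈ˡ exs D → e ∈ˡ allExs
    facts-exs D∈ = proj₁ (proj₂ (proj₁ (proj₂ saturation)) D∈)

    facts-initial : ∀ {x D} → (x , D) ∈ˡ initial → (x , D) ∈ˡ facts
    facts-initial = proj₁ (proj₂ (proj₂ saturation))

    facts-closed : ∀ {x rs C D} → x ∈ˡ allNodes → (rs , C , D) ∈ˡ allGCIs →
                   All (λ r → HasRan r x) rs → Holds facts C x → (x , D) ∈ˡ facts
    facts-closed x∈ g∈ hrs c = proj₂ (proj₂ (proj₂ saturation))
      (∈-cartesianProduct⁺ x∈ (∈-map⁺ (proj₂ ∘ proj₂) g∈)) (lose g∈ (refl , hrs , c))

  labelsAt : Node → List ConceptName
  labelsAt = told facts names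

  exsAt : Node → List (RoleName × Concept)
  exsAt = told facts exs

  labelsAt-graph : ∀ {A v} → (A , v) ∈ˡ labels → A ∈ˡ labelsAt (ind v)
  labelsAt-graph A∈ = told⁺ names (facts-initial (∈-++⁺ˡ (∈-map⁺ initialLabel A∈))) (here refl)

  labelsAt-sound : ∀ {A x} → A ∈ˡ labelsAt x → Sound depth x (name A)
  labelsAt-sound A∈ ℐ ℐ⊨𝒯 d∈ with told⁻ names A∈
  ... | D , D∈ , A∈D = names-sound ℐ D A∈D (facts-sound D∈ ℐ ℐ⊨𝒯 d∈)

  exsAt-sound : ∀ {r C x} → (r , C) ∈ˡ exsAt x → Sound depth x (∃⟨ r ⟩ C)
  exsAt-sound e∈ ℐ ℐ⊨𝒯 d∈ with told⁻ exs e∈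
  ... | D , D∈ , e∈D = exs-sound ℐ D e∈D (facts-sound D∈ ℐ ℐ⊨𝒯 d∈)

  exsAt⊆allExs : ∀ {e x} → e ∈ˡ exsAt x → e ∈ˡ allExs
  exsAt⊆allExs e∈ with told⁻ exs e∈
  ... | D , D∈ , e∈D = facts-exs D∈ e∈D

  exsAt⊆allNodes : ∀ {e x} → e ∈ˡ exsAt x → wit e ∈ˡ allNodes
  exsAt⊆allNodes e∈ = ∈-++⁺ʳ (map ind nodes) (∈-map⁺ wit (exsAt⊆allExs e∈))

  module _ {r : RoleName} {C : Concept} {x : Node} (e∈ : (r , C) ∈ˡ exsAt x) where
    private
      initial∈ : (wit (r , C) , C) ∈ˡ facts
      initial∈ = facts-initial (∈-++⁺ʳ (map initialLabel labels) (∈-map⁺ initialWitness (exsAt⊆allExs e∈)))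

    witness-names : ∀ {A} → A ∈ˡ names C → A ∈ˡ labelsAt (wit (r , C))
    witness-names = told⁺ names initial∈

    witness-exs : ∀ {f} → f ∈ˡ exs C → f ∈ˡ exsAt (wit (r , C))
    witness-exs = told⁺ exs initial∈

  EdgeTo-super : ∀ {s t} x {w} → (s , t) ∈ˡ concatMap roleInclusions 𝒯 → EdgeTo s x w → EdgeTo t x w
  EdgeTo-super (ind v) p∈ = Any.map λ {e} (eq , s∈) → eq , supers-step 𝒯 (proj₁ e) s∈ p∈

  -- The canonical model of 𝒯 and 𝒢, unravelled: its elements are the paths (a , eₖ ∷ ⋯ ∷ e₁)
  -- that start in a root a and follow the existential restrictions e₁, …, eₖ. Several roots may
  -- share a vertex of 𝒢, so that infinitely many of them are served by finitely many vertices.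
  module Model {Root : Set} (start : Root → V) (start∈ : ∀ a → start a ∈ˡ nodes)
               (root₀ : Root) (individual : IndName → Root) where

    Path : Set
    Path = Root × List (RoleName × Concept)

    tail : Path → Node
    tail (a , [])    = ind (start a)
    tail (a , e ∷ _) = wit e

    IsPath : Path → Set
    IsPath (a , [])     = Unit.⊤
    IsPath (a , e ∷ es) = e ∈ˡ exsAt (tail (a , es)) × IsPath (a , es)

    -- A path of positive length is entered only from the path it prolongs. The treatment of queries
    -- rests on this tree shape.
    PathEdge : RoleName → Path → Path → Set
    PathEdge s (a , es) (b , [])           = es ≡ [] × BaseEdge s (start a) (start b)
    PathEdge s p        (b , (r , _) ∷ es) = p ≡ (b , es) × s ∈ˡ supers 𝒯 r

    model : Interpretation
    model = record
      { Δ        = ∃ IsPath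
      ; nonempty = (root₀ , []) , _
      ; ⟦_⟧ᴬ     = λ A (p , _) → A ∈ˡ labelsAt (tail p)
      ; ⟦_⟧ʳ     = λ s (p , _) (q , _) → PathEdge s p q
      ; ⟦_⟧ⁱ     = λ a → (individual a , []) , _
      }

    tail∈ : ∀ p → IsPath p → tail p ∈ˡ allNodes
    tail∈ (a , [])     _        = ∈-++⁺ˡ (∈-map⁺ ind (start∈ a))
    tail∈ (a , e ∷ es) (e∈ , _) = exsAt⊆allNodes e∈

    -- Each edge of the model projects to a step between tails, so a GCI whose left side is true at
    -- a path has fired at its tail.
    model-Holds : ∀ C {d} → ⟦_⟧ model C d → Holds facts C (tail (proj₁ d))
    model-Holds (name A)   d∈        = d∈
    model-Holds ⊤          d∈        = _
    model-Holds (C ⊓ D)    (c , d)   = model-Holds C c , model-Holds D d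
    model-Holds (∃⟨ s ⟩ C) {(a , []) , _} (((b , []) , _) , (refl , b∈) , c) =
      inj₂ (lose (start∈ b) (b∈ , model-Holds C c))
    model-Holds (∃⟨ s ⟩ C) (((b , e ∷ es) , e∈ , _) , (refl , s∈) , c) =
      inj₁ (lose e∈ (s∈ , model-Holds C c))

    model-HasRan : ∀ {s} d → ⟦ran_⟧ model s d → HasRan s (tail (proj₁ d))
    model-HasRan ((b , [])    , _) (((a , _) , _) , refl , b∈) = lose (start∈ a) b∈
    model-HasRan ((b , _ ∷ _) , _) (_ , _ , s∈)                = s∈

    -- Checking the top-level conjuncts suffices: the path prolonged by `(r , C)` ends in a node
    -- that was told `C` from the start.
    told⇒⟦⟧ : ∀ C {d} → (∀ {A} → A ∈ˡ names C → A ∈ˡ labelsAt (tail (proj₁ d))) →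
              (∀ {e} → e ∈ˡ exs C → e ∈ˡ exsAt (tail (proj₁ d))) → ⟦_⟧ model C d
    told⇒⟦⟧ (name A)   hn he = hn (here refl)
    told⇒⟦⟧ ⊤          hn he = _
    told⇒⟦⟧ (C ⊓ D)    hn he =
      told⇒⟦⟧ C (hn ∘ ∈-++⁺ˡ) (he ∘ ∈-++⁺ˡ) , told⇒⟦⟧ D (hn ∘ ∈-++⁺ʳ (names C)) (he ∘ ∈-++⁺ʳ (exs C))
    told⇒⟦⟧ (∃⟨ r ⟩ C) {(a , es) , p} hn he =
      ((a , (r , C) ∷ es) , e∈ , p) , (refl , supers-refl 𝒯 r) , told⇒⟦⟧ C (witness-names e∈) (witness-exs e∈)
      where e∈ = he (here refl)

    model⊨𝒯 : model ⊨ᵀ 𝒯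
    model⊨𝒯 = ⊨ᵀ⁺
      (λ { {rs , C , D} g∈ {d} hrs c →
        let D∈ = facts-closed (uncurry tail∈ d) g∈ (All.map (model-HasRan d) hrs) (model-Holds C c)
        in told⇒⟦⟧ D (told⁺ names D∈) (told⁺ exs D∈) })
      (λ p∈ {d} {d′} → roleStep p∈ (proj₁ d) (proj₁ d′))
      where
      roleStep : ∀ {s t} → (s , t) ∈ˡ concatMap roleInclusions 𝒯 → ∀ p q → PathEdge s p q → PathEdge t p q
      roleStep p∈ (a , es) (b , [])           (eq , b∈) = eq , EdgeTo-super (ind (start a)) p∈ b∈
      roleStep p∈ p        (b , (r , _) ∷ es) (eq , s∈) = eq , supers-step 𝒯 r s∈ p∈

    model-edge : ∀ {r a b} → (r , start a , start b) ∈ˡ edges → PathEdge r (a , []) (b , [])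
    model-edge {r} r∈ = refl , lose r∈ (refl , supers-refl 𝒯 r)

  -- Deciding truth in all targets of a graph

  module Decision (total : ∀ v → v ∈ˡ nodes) (v₀ : V) where
    open Model id total v₀ (λ _ → v₀)

    -- A vertex stands for its very image, not for every element satisfying its unravelling.
    -- Parallel edges then lead to one element, as a restriction over a role conjunction demands.
    Represents : ∀ ℐ → (V → Δ ℐ) → Node → Pred (Δ ℐ) 0ℓ
    Represents ℐ h (ind v) d = d ≡ h v
    Represents ℐ h (wit e) d = Described 0 (wit e) ℐ d

    Represents⇒Described : ∀ {ℐ h} → Homomorphism 𝒢 ℐ h → ∀ n x → Represents ℐ h x ⊆ Described n x ℐ
    Represents⇒Described {ℐ} hom n (ind v) refl = hom-unravel ℐ hom n v
    Represents⇒Described     hom n (wit _) d∈   = d∈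

    private
      Successor : List Node → Pred Node 0ℓ
      Successor L y = Any (λ x → y ∈ˡ map wit (exsAt x)) L

      Successor? : ∀ L → Decidable (Successor L)
      Successor? L y = any? (λ x → any? (y ≟ᴺ_) (map wit (exsAt x))) L

      -- `allNodes` may list witnesses of restrictions that are enforced nowhere. Hence ∃u is
      -- confined to nodes represented in every model of `𝒯` that receives the graph.
      Inhabited : Pred (List Node) _
      Inhabited L = ∀ {y} → y ∈ˡ L → ∀ ℐ → ℐ ⊨ᵀ 𝒯 → ∀ {h} → Homomorphism 𝒢 ℐ h → ∃ (Represents ℐ h y)

      extendReachable : ∀ {L y} → Inhabited L → Successor L y → Inhabited (y ∷ L)
      extendReachable inv step (there y∈) = inv y∈
      extendReachable inv step (here refl) ℐ ℐ⊨𝒯 hom with find step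
      ... | x , x∈ , y∈ with ∈-map⁻ wit y∈ | inv x∈ ℐ ℐ⊨𝒯 hom
      ...   | e , e∈ , refl | d , d∈ with exsAt-sound e∈ ℐ ℐ⊨𝒯 (Represents⇒Described hom depth x d∈)
      ...     | d′ , rdd′ , d′∈ = d′ , (d , rdd′) , d′∈

      inds-inhabited : Inhabited (map ind nodes)
      inds-inhabited y∈ ℐ ℐ⊨𝒯 {h} hom with ∈-map⁻ ind y∈
      ... | v , _ , refl = h v , refl

      reachability = saturate Successor Successor? Inhabited extendReachable (map ind nodes) allNodes inds-inhabited

    abstract
      reachable : List Node
      reachable = proj₁ reachability

      reachable-inhabited : Inhabited reachable
      reachable-inhabited = proj₁ (proj₂ reachability)

      tail-reachable : ∀ p → IsPath p → tail p ∈ˡ reachable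
      tail-reachable (a , [])     _        = proj₁ (proj₂ (proj₂ reachability)) (∈-map⁺ ind (total a))
      tail-reachable (a , e ∷ es) (e∈ , p) = proj₂ (proj₂ (proj₂ reachability)) (exsAt⊆allNodes e∈)
        (lose (tail-reachable (a , es) p) (∈-map⁺ wit e∈))

    Holds⊓u : Concept⊓u → Pred Node 0ℓ
    Holds⊓u (name A)   x = A ∈ˡ labelsAt x
    Holds⊓u ⊤          x = Unit.⊤
    Holds⊓u (C ⊓ D)    x = Holds⊓u C x × Holds⊓u D x
    Holds⊓u (∃⟨ R ⟩ C) x = Any (λ e → All (_∈ˡ supers 𝒯 (proj₁ e)) (toList R) × Holds⊓u C (wit e)) (exsAt x)
                         ⊎ Any (λ w → All (λ s → EdgeTo s x w) (toList R) × Holds⊓u C (ind w)) nodes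
    Holds⊓u (∃u C)     x = Any (Holds⊓u C) reachable

    Holds⊓u? : ∀ C x → Dec (Holds⊓u C x)
    Holds⊓u? (name A)   x = A ∈ᶜⁿ? labelsAt x
    Holds⊓u? ⊤          x = yes _
    Holds⊓u? (C ⊓ D)    x = Holds⊓u? C x ×-dec Holds⊓u? D x
    Holds⊓u? (∃⟨ R ⟩ C) x =
            any? (λ e → All.all? (_∈ʳ? supers 𝒯 (proj₁ e)) (toList R) ×-dec Holds⊓u? C (wit e)) (exsAt x)
      ⊎-dec any? (λ w → All.all? (λ s → EdgeTo? s x w) (toList R) ×-dec Holds⊓u? C (ind w)) nodes
    Holds⊓u? (∃u C)     x = any? (Holds⊓u? C) reachable

    Holds⊓u-sound : ∀ {ℐ h} → ℐ ⊨ᵀ 𝒯 → Homomorphism 𝒢 ℐ h →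
                    ∀ C x → Holds⊓u C x → Represents ℐ h x ⊆ ⟦_⟧⊓u ℐ C
    Holds⊓u-sound {ℐ} ℐ⊨𝒯 hom (name A) x A∈ d∈ =
      labelsAt-sound A∈ ℐ ℐ⊨𝒯 (Represents⇒Described hom depth x d∈)
    Holds⊓u-sound ℐ⊨𝒯 hom ⊤ x _ d∈ = _
    Holds⊓u-sound ℐ⊨𝒯 hom (C ⊓ D) x (c , d) d∈ =
      Holds⊓u-sound ℐ⊨𝒯 hom C x c d∈ , Holds⊓u-sound ℐ⊨𝒯 hom D x d d∈
    Holds⊓u-sound {ℐ} ℐ⊨𝒯 hom (∃⟨ R ⟩ C) x (inj₁ a) d∈ with find a
    ... | (r , E) , e∈ , R⊆ , c with exsAt-sound e∈ ℐ ℐ⊨𝒯 (Represents⇒Described hom depth x d∈)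
    ...   | d′ , rdd′ , d′∈ = d′ , All.map (λ s∈ → supers-sound 𝒯 r s∈ ℐ ℐ⊨𝒯 rdd′) R⊆ ,
                              Holds⊓u-sound ℐ⊨𝒯 hom C (wit (r , E)) c ((_ , rdd′) , d′∈)
    Holds⊓u-sound {ℐ} {h} ℐ⊨𝒯 hom (∃⟨ R ⟩ C) (ind v) (inj₂ a) refl with find a
    ... | w , _ , R⊆ , c = h w , All.map base R⊆ , Holds⊓u-sound ℐ⊨𝒯 hom C (ind w) c refl
      where
      base : ∀ {s} → BaseEdge s v w → ⟦_⟧ʳ ℐ s (h v) (h w)
      base b with BaseEdge-sound b
      ... | r , r∈ , s∈ = supers-sound 𝒯 r s∈ ℐ ℐ⊨𝒯 (Homomorphism.edge hom r∈)
    Holds⊓u-sound ℐ⊨𝒯 hom (∃⟨ R ⟩ C) (wit _) (inj₂ a) d∈ with find a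
    ... | _ , _ , () ∷ _ , _
    Holds⊓u-sound {ℐ} ℐ⊨𝒯 hom (∃u C) x a d∈ with find a
    ... | y , y∈ , c with reachable-inhabited y∈ ℐ ℐ⊨𝒯 hom
    ...   | d′ , d′∈ = d′ , Holds⊓u-sound ℐ⊨𝒯 hom C y c d′∈

    Holds⊓u-complete : ∀ C {d} → ⟦_⟧⊓u model C d → Holds⊓u C (tail (proj₁ d))
    Holds⊓u-complete (name A)   d∈      = d∈
    Holds⊓u-complete ⊤          d∈      = _
    Holds⊓u-complete (C ⊓ D)    (c , d) = Holds⊓u-complete C c , Holds⊓u-complete D d
    Holds⊓u-complete (∃⟨ R ⟩ C) {(a , []) , _} (((b , []) , _) , R⊆ , c) =
      inj₂ (lose (total b) (All.map proj₂ R⊆ , Holds⊓u-complete C c))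
    Holds⊓u-complete (∃⟨ R ⟩ C) {(a , _ ∷ _) , _} (((b , []) , _) , ((() , _) ∷ _) , c)
    -- Since `R` is nonempty, its first role already identifies the source as the parent path.
    Holds⊓u-complete (∃⟨ R ⟩ C) (((b , e ∷ es) , e∈ , _) , R⊆@((refl , _) ∷ _) , c) =
      inj₁ (lose e∈ (All.map proj₂ R⊆ , Holds⊓u-complete C c))
    Holds⊓u-complete (∃u C) ((p , isPath) , c) = lose (tail-reachable p isPath) (Holds⊓u-complete C c)

    root : V → Δ model
    root v = (v , []) , _

    root-hom : Homomorphism 𝒢 model root
    root-hom = record { label = labelsAt-graph ; edge = model-edge }

    -- The canonical model receives the graph by `root-hom`, so it is one of the targets; `Holds⊓u`
    -- carries truth from it to all the others.
    ⟦⟧⊓u-everywhere? : ∀ D v → (∀ ℐ → ℐ ⊨ᵀ 𝒯 → ∀ {h} → Homomorphism 𝒢 ℐ h → ⟦_⟧⊓u ℐ D (h v))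
                     ⊎ ¬ ⟦_⟧⊓u model D (root v)
    ⟦⟧⊓u-everywhere? D v with Holds⊓u? D (ind v)
    ... | yes h = inj₁ λ ℐ ℐ⊨𝒯 hom → Holds⊓u-sound ℐ⊨𝒯 hom D (ind v) h refl
    ... | no ¬h = inj₂ λ d∈ → ¬h (Holds⊓u-complete D d∈)

-- Syntax trees as graphs, and the decision of single inclusions

-- The vertices of the syntax tree of a concept other than its root; a conjunct ran(r) has a vertex of
-- its own, the source of an r-edge into the vertex it describes.
Position : ConceptRan → Set
Position (name A)   = ⊥
Position ⊤          = ⊥
Position (ran r)    = Unit.⊤
Position (C ⊓ D)    = Position C ⊎ Position D
Position (∃⟨ r ⟩ C) = Maybe (Position C)

≟-position : ∀ C → DecidableEquality (Position C)
≟-position (ran r)    _ _ = yes refl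
≟-position (C ⊓ D)    = Sum.≡-dec (≟-position C) (≟-position D)
≟-position (∃⟨ r ⟩ C) = Maybe.≡-dec (≟-position C)

positions : ∀ C → List (Position C)
positions (name A)   = []
positions ⊤          = []
positions (ran r)    = [ _ ]
positions (C ⊓ D)    = map inj₁ (positions C) ++ map inj₂ (positions D)
positions (∃⟨ r ⟩ C) = nothing ∷ map just (positions C)

position∈ : ∀ C p → p ∈ˡ positions C
position∈ (ran r)    _        = here refl
position∈ (C ⊓ D)    (inj₁ p) = ∈-++⁺ˡ (∈-map⁺ inj₁ (position∈ C p))
position∈ (C ⊓ D)    (inj₂ p) = ∈-++⁺ʳ (map inj₁ (positions C)) (∈-map⁺ inj₂ (position∈ D p))
position∈ (∃⟨ r ⟩ C) nothing  = here refl
position∈ (∃⟨ r ⟩ C) (just p) = there (∈-map⁺ just (position∈ C p))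

_∪ᴳ_ : {V : Set} → Graph V → Graph V → Graph V
graph l e ∪ᴳ graph l′ e′ = graph (l ++ l′) (e ++ e′)

-- The vertices are supplied by `v` and `f`, so that all subconcepts write into one vertex type and
-- their graphs can simply be joined.
conceptGraph : {V : Set} (C : ConceptRan) → V → (Position C → V) → Graph V
conceptGraph (name A)   v f = graph [ A , v ] []
conceptGraph ⊤          v f = graph [] []
conceptGraph (ran r)    v f = graph [] [ r , f _ , v ]
conceptGraph (C ⊓ D)    v f = conceptGraph C v (f ∘ inj₁) ∪ᴳ conceptGraph D v (f ∘ inj₂)
conceptGraph (∃⟨ r ⟩ C) v f = graph [] [ r , v , f nothing ] ∪ᴳ conceptGraph C (f nothing) (f ∘ just)

module _ {V : Set} {ℐ : Interpretation} {h : V → Δ ℐ} where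

  ∪ᴳ-hom⁺ : ∀ {𝒢 ℋ} → Homomorphism 𝒢 ℐ h → Homomorphism ℋ ℐ h → Homomorphism (𝒢 ∪ᴳ ℋ) ℐ h
  ∪ᴳ-hom⁺ {𝒢} {ℋ} hom hom′ = record { label = label ∘ ∈-++⁻ (Graph.labels 𝒢) ; edge = edge ∘ ∈-++⁻ (Graph.edges 𝒢) }
    where
    label : ∀ {A v} → (A , v) ∈ˡ Graph.labels 𝒢 ⊎ (A , v) ∈ˡ Graph.labels ℋ → ⟦_⟧ᴬ ℐ A (h v)
    label (inj₁ A∈) = Homomorphism.label hom A∈
    label (inj₂ A∈) = Homomorphism.label hom′ A∈
    edge : ∀ {r v w} → (r , v , w) ∈ˡ Graph.edges 𝒢 ⊎ (r , v , w) ∈ˡ Graph.edges ℋ → ⟦_⟧ʳ ℐ r (h v) (h w)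
    edge (inj₁ r∈) = Homomorphism.edge hom r∈
    edge (inj₂ r∈) = Homomorphism.edge hom′ r∈

  ∪ᴳ-hom⁻ : ∀ {𝒢 ℋ} → Homomorphism (𝒢 ∪ᴳ ℋ) ℐ h → Homomorphism 𝒢 ℐ h × Homomorphism ℋ ℐ h
  ∪ᴳ-hom⁻ {𝒢} hom =
    record { label = label ∘ ∈-++⁺ˡ ; edge = edge ∘ ∈-++⁺ˡ } ,
    record { label = label ∘ ∈-++⁺ʳ (Graph.labels 𝒢) ; edge = edge ∘ ∈-++⁺ʳ (Graph.edges 𝒢) }
    where open Homomorphism hom

  conceptGraph-sound : ∀ C v f → Homomorphism (conceptGraph C v f) ℐ h → ⟦_⟧ran ℐ C (h v)
  conceptGraph-sound (name A)   v f hom = Homomorphism.label hom (here refl)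
  conceptGraph-sound ⊤          v f hom = _
  conceptGraph-sound (ran r)    v f hom = _ , Homomorphism.edge hom (here refl)
  conceptGraph-sound (C ⊓ D)    v f hom =
    let homC , homD = ∪ᴳ-hom⁻ {conceptGraph C v _} hom
    in conceptGraph-sound C v _ homC , conceptGraph-sound D v _ homD
  conceptGraph-sound (∃⟨ r ⟩ C) v f hom =
    let homr , homC = ∪ᴳ-hom⁻ {graph [] _} hom
    in h (f nothing) , Homomorphism.edge homr (here refl) , conceptGraph-sound C (f nothing) _ homC

module _ (ℐ : Interpretation) where

  place : ∀ C {d} → ⟦_⟧ran ℐ C d → Position C → Δ ℐ
  place (ran r)    (e , _)      _        = e
  place (C ⊓ D)    (c , d)      (inj₁ p) = place C c p
  place (C ⊓ D)    (c , d)      (inj₂ p) = place D d p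
  place (∃⟨ r ⟩ C) (e , _ , c)  nothing  = e
  place (∃⟨ r ⟩ C) (e , _ , c)  (just p) = place C c p

  place-hom : ∀ {V : Set} {h : V → Δ ℐ} C {v f d} (d∈ : ⟦_⟧ran ℐ C d) →
              h v ≡ d → (∀ p → h (f p) ≡ place C d∈ p) → Homomorphism (conceptGraph C v f) ℐ h
  place-hom (name A)   d∈ refl h≡ = record { label = λ { (here refl) → d∈ } ; edge = λ () }
  place-hom ⊤          d∈ refl h≡ = record { label = λ () ; edge = λ () }
  place-hom {h = h} (ran r) {v} (e , red) refl h≡ = record
    { label = λ ()
    ; edge  = λ { (here refl) → subst (λ x → ⟦_⟧ʳ ℐ r x (h v)) (sym (h≡ _)) red }
    }
  place-hom (C ⊓ D)    (c , d) eq h≡ = ∪ᴳ-hom⁺ (place-hom C c eq (h≡ ∘ inj₁)) (place-hom D d eq (h≡ ∘ inj₂))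
  place-hom {h = h} (∃⟨ r ⟩ C) {v} (e , rde , c) refl h≡ =
    ∪ᴳ-hom⁺ {𝒢 = graph [] _} edge (place-hom C c (h≡ nothing) (h≡ ∘ just))
    where
    edge = record
      { label = λ ()
      ; edge  = λ { (here refl) → subst (⟦_⟧ʳ ℐ r (h v)) (sym (h≡ nothing)) rde }
      }

module _ (𝒯 : TBox) (C : ConceptRan) where

  private
    vertices : List (Maybe (Position C))
    vertices = nothing ∷ map just (positions C)

    vertex∈ : ∀ v → v ∈ˡ vertices
    vertex∈ nothing  = here refl
    vertex∈ (just p) = there (∈-map⁺ just (position∈ C p))

    open Canonical 𝒯 (Maybe.≡-dec (≟-position C)) (conceptGraph C nothing just) vertices
    open Decision vertex∈ nothing
    open Model id vertex∈ nothing (λ _ → nothing) using (model⊨𝒯)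

  -- The instances of `C` are exactly the images of the root under homomorphisms from the syntax
  -- tree, so the question is whether `D` holds at every such image.
  conceptInclusion? : ∀ D → Dec (𝒯 entails (C ⊑ D))
  conceptInclusion? D with ⟦⟧⊓u-everywhere? D nothing
  ... | inj₂ fails = no λ entailed →
    fails (entailed _ model⊨𝒯 (conceptGraph-sound C nothing just root-hom))
  ... | inj₁ everywhere = yes entailed
    where
    entailed : 𝒯 entails (C ⊑ D)
    entailed ℐ ℐ⊨𝒯 {d} d∈ = everywhere ℐ ℐ⊨𝒯 {h} (place-hom ℐ C d∈ refl λ _ → refl)
      where
      h : Maybe (Position C) → Δ ℐ
      h nothing  = d
      h (just p) = place ℐ C d∈ p

module _ (𝒯 : TBox) (r : RoleName) where

  private
    -- Everything holds, except that distinct elements are related by the super-roles of r only.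
    countermodel : Interpretation
    countermodel = record
      { Δ        = Bool
      ; nonempty = true
      ; ⟦_⟧ᴬ     = λ _ → U
      ; ⟦_⟧ʳ     = λ s x y → x ≡ y ⊎ s ∈ˡ supers 𝒯 r
      ; ⟦_⟧ⁱ     = λ _ → true
      }

    -- Every role has a loop at `d`, so `d` is its own successor for each restriction; the right
    -- side of every GCI is therefore true everywhere.
    full : ∀ C d → ⟦_⟧ countermodel C d
    full (name A)   d = _
    full ⊤          d = _
    full (C ⊓ D)    d = full C d , full D d
    full (∃⟨ s ⟩ C) d = d , inj₁ refl , full C d

    countermodel⊨𝒯 : countermodel ⊨ᵀ 𝒯
    countermodel⊨𝒯 = ⊨ᵀ⁺ (λ { {_ , _ , D} _ {d} _ _ → full D d })
      (λ { p∈ (inj₁ eq) → inj₁ eq ; p∈ (inj₂ s∈) → inj₂ (supers-step 𝒯 r s∈ p∈) })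

  roleInclusion? : ∀ s → Dec (𝒯 entails (r ⊑ʳ s))
  roleInclusion? s with s ∈ʳ? supers 𝒯 r
  ... | yes s∈ = yes (supers-sound 𝒯 r s∈)
  ... | no  s∉ = no λ entailed → refute (entailed countermodel countermodel⊨𝒯 {false} {true} (inj₂ (supers-refl 𝒯 r)))
    where
    refute : ¬ (false ≡ true ⊎ s ∈ˡ supers 𝒯 r)
    refute (inj₂ s∈) = s∉ s∈

entails? : ∀ 𝒯 α → Dec (𝒯 entails α)
entails? 𝒯 (C ⊑ D)  = conceptInclusion? 𝒯 C D
entails? 𝒯 (r ⊑ʳ s) = roleInclusion? 𝒯 r s

-- Optional list entries and finite conjunctions

guard : {P : Set} → Dec P → A → List A
guard (yes _) x = [ x ]
guard (no _)  x = []

guard⁺ : ∀ {P} (P? : Dec P) {x : A} → P → x ∈ˡ guard P? x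
guard⁺ (yes _) p = here refl
guard⁺ (no ¬p) p = contradiction p ¬p

guard⁻ : ∀ {P} (P? : Dec P) {x y : A} → y ∈ˡ guard P? x → P × y ≡ x
guard⁻ (yes p) (here refl) = p , refl

member? : (xs : List A) → ∃ (_∈ˡ xs) ⊎ (∀ {x} → ¬ x ∈ˡ xs)
member? []      = inj₂ λ ()
member? (x ∷ _) = inj₁ (x , here refl)

⨅⊓u : List Concept⊓u → Concept⊓u
⨅⊓u = foldr _⊓_ ⊤

module _ (ℐ : Interpretation) {d : Δ ℐ} where

  ⨅⊓u⁺ : ∀ Cs → (∀ {C} → C ∈ˡ Cs → ⟦_⟧⊓u ℐ C d) → ⟦_⟧⊓u ℐ (⨅⊓u Cs) d
  ⨅⊓u⁺ []       h = _
  ⨅⊓u⁺ (C ∷ Cs) h = h (here refl) , ⨅⊓u⁺ Cs (h ∘ there)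

  ⨅⊓u⁻ : ∀ Cs → ⟦_⟧⊓u ℐ (⨅⊓u Cs) d → ∀ {C} → C ∈ˡ Cs → ⟦_⟧⊓u ℐ C d
  ⨅⊓u⁻ (C ∷ Cs) (x , _)  (here refl) = x
  ⨅⊓u⁻ (C ∷ Cs) (_ , xs) (there C∈)  = ⨅⊓u⁻ Cs xs C∈

sig-⨅⊓u : ∀ Cs {σ : Signature} → (∀ {C} → C ∈ˡ Cs → sigConcept⊓u C ⊆ σ) → sigConcept⊓u (⨅⊓u Cs) ⊆ σ
sig-⨅⊓u (C ∷ Cs) h (inj₁ s∈C)  = h (here refl) s∈C
sig-⨅⊓u (C ∷ Cs) h (inj₂ s∈Cs) = sig-⨅⊓u Cs (h ∘ there) s∈Cs

-- The ABox as a graph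

-- The vertex nothing, without labels and edges, serves the individuals that do not occur in the ABox.
module ABoxGraph (𝒜 : ABox) where

  private
    labelOf : Assertion → List (ConceptName × Maybe IndName)
    labelOf (concept A a) = [ A , just a ]
    labelOf _             = []

    edgeOf : Assertion → List (RoleName × Maybe IndName × Maybe IndName)
    edgeOf (role r a b) = [ r , just a , just b ]
    edgeOf _            = []

    indsOf : Assertion → List IndName
    -- An individual that occurs only in ⊤-assertions has neither label nor edge, so `nothing`
    -- serves it as well.
    indsOf (top a)       = []
    indsOf (concept A a) = [ a ]
    indsOf (role r a b)  = a ∷ b ∷ []

    inds : List IndName
    inds = concatMap indsOf (toList 𝒜)

    inds∈ : ∀ {α a} → α ∈ˡ toList 𝒜 → a ∈ˡ indsOf α → a ∈ˡ inds
    inds∈ α∈ a∈ = ∈-concatMap⁺ indsOf (lose α∈ a∈)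

  aboxGraph : Graph (Maybe IndName)
  aboxGraph = graph (concatMap labelOf (toList 𝒜)) (concatMap edgeOf (toList 𝒜))

  open Graph aboxGraph

  vertices : List (Maybe IndName)
  vertices = nothing ∷ map just inds

  vertexOf : ∀ {a} → Dec (a ∈ˡ inds) → Maybe IndName
  vertexOf {a} (yes _) = just a
  vertexOf     (no _)  = nothing

  open import Data.List.Membership.DecPropositional _≟ⁱ_ using () renaming (_∈?_ to _∈ⁱ?_)

  vertex : IndName → Maybe IndName
  vertex a = vertexOf (a ∈ⁱ? inds)

  vertex∈ : ∀ a → vertex a ∈ˡ vertices
  vertex∈ a with a ∈ⁱ? inds
  ... | yes a∈ = there (∈-map⁺ just a∈)
  ... | no  _  = here refl

  vertex-just : ∀ {a b} → vertex a ≡ just b → a ≡ b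
  vertex-just {a} eq with a ∈ⁱ? inds
  vertex-just refl | yes _ = refl

  vertex-inds : ∀ {a} → a ∈ˡ inds → just a ≡ vertex a
  vertex-inds {a} a∈ with a ∈ⁱ? inds
  ... | yes _  = refl
  ... | no  a∉ = contradiction a∈ a∉

  labels⁺ : ∀ {A a} → concept A a ∈ˡ toList 𝒜 → (A , vertex a) ∈ˡ labels
  labels⁺ {A} α∈ = subst (λ v → (A , v) ∈ˡ labels) (vertex-inds (inds∈ α∈ (here refl)))
    (∈-concatMap⁺ labelOf (lose α∈ (here refl)))

  edges⁺ : ∀ {r a b} → role r a b ∈ˡ toList 𝒜 → (r , vertex a , vertex b) ∈ˡ edges
  edges⁺ {r} {a} {b} α∈ = subst (λ e → (r , e) ∈ˡ edges)
    (Product.×-≡,≡→≡ (vertex-inds (inds∈ α∈ (here refl)) , vertex-inds (inds∈ α∈ (there (here refl)))))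
    (∈-concatMap⁺ edgeOf (lose α∈ (here refl)))

  labels⁻ : ∀ {A v} → (A , v) ∈ˡ labels → ∃ λ a → v ≡ just a × concept A a ∈ˡ toList 𝒜
  labels⁻ l∈ with find (∈-concatMap⁻ labelOf {xs = toList 𝒜} l∈)
  ... | concept A a , α∈ , here refl = a , refl , α∈

  edges⁻ : ∀ {r v w} → (r , v , w) ∈ˡ edges → ∃₂ λ a b → v ≡ just a × w ≡ just b × role r a b ∈ˡ toList 𝒜
  edges⁻ e∈ with find (∈-concatMap⁻ edgeOf {xs = toList 𝒜} e∈)
  ... | role r a b , α∈ , here refl = a , b , refl , refl , α∈

  module _ {ℐ : Interpretation} (ℐ⊨𝒜 : ℐ ⊨ᴬ 𝒜) where

    private
      assign : Δ ℐ → Maybe IndName → Δ ℐ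
      assign d nothing  = d
      assign d (just a) = ⟦_⟧ⁱ ℐ a

    assign-hom : ∀ d → Homomorphism aboxGraph ℐ (assign d)
    assign-hom d = record { label = label ; edge = edge }
      where
      label : ∀ {A v} → (A , v) ∈ˡ labels → ⟦_⟧ᴬ ℐ A (assign d v)
      label l∈ with labels⁻ l∈
      ... | a , refl , α∈ = All.lookup ℐ⊨𝒜 α∈
      edge : ∀ {r v w} → (r , v , w) ∈ˡ edges → ⟦_⟧ʳ ℐ r (assign d v) (assign d w)
      edge e∈ with edges⁻ e∈
      ... | a , b , refl , refl , α∈ = All.lookup ℐ⊨𝒜 α∈

    open Unravelling (Maybe.≡-dec _≟ⁱ_) aboxGraph

    -- The value of `nothing` under a homomorphism is free. Choosing the value of `a` for it covers
    -- the individuals served by `nothing`.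
    individual-unravel : ∀ n a → ⟦_⟧ran ℐ (unravel n (vertex a)) (⟦_⟧ⁱ ℐ a)
    individual-unravel n a = subst (⟦_⟧ran ℐ (unravel n (vertex a))) assign-vertex
      (hom-unravel ℐ (assign-hom (⟦_⟧ⁱ ℐ a)) n (vertex a))
      where
      assign-vertex : assign (⟦_⟧ⁱ ℐ a) (vertex a) ≡ ⟦_⟧ⁱ ℐ a
      assign-vertex with a ∈ⁱ? inds
      ... | yes _ = refl
      ... | no  _ = refl

-- Query matches in the canonical model, and their transfer

module QueryMatch (𝒯 : TBox) (𝒜 : ABox) {n m : ℕ} (ψ : List (Atom n m)) (a⃗ : Vec IndName n) where
  open ABoxGraph 𝒜 public
  open Canonical 𝒯 (Maybe.≡-dec _≟ⁱ_) aboxGraph vertices public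
  -- Every individual name is a root: an interpretation must give each of them a value, and the
  -- query may mention any.
  open Model vertex vertex∈ (indName 0) id public
  open Unravelling (Maybe.≡-dec _≟ⁱ_) aboxGraph using (unravel; sig-unravel) public

  model⊨𝒜 : model ⊨ᴬ 𝒜
  model⊨𝒜 = All.tabulate λ {α} → assertion α
    where
    assertion : ∀ α → α ∈ˡ toList 𝒜 → satisfiesAssertion model α
    assertion (top a)       α∈ = _
    assertion (concept A a) α∈ = labelsAt-graph (labels⁺ α∈)
    assertion (role r a b)  α∈ = model-edge (edges⁺ α∈)

  _≟ᵖ_ : DecidableEquality Path
  _≟ᵖ_ = Product.≡-dec _≟ⁱ_ (List.≡-dec _≟ᵉ_)

  parent : Path → Maybe Path
  parent (a , [])     = nothing
  parent (a , _ ∷ es) = just (a , es)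

  HasParent? : ∀ q p → Dec (parent q ≡ just p)
  HasParent? q p = Maybe.≡-dec _≟ᵖ_ (parent q) (just p)

  module _ (ρ : Fin m → Δ model) (match : All (satisfiesAtom model (λ i → ⟦_⟧ⁱ model (lookup a⃗ i)) ρ) ψ) where

    termValue : Term n m → Δ model
    termValue = ⟦_⟧ᵗ model (λ i → ⟦_⟧ⁱ model (lookup a⃗ i)) ρ

    path : Term n m → Path
    path = proj₁ ∘ termValue

    termsOf : Atom n m → List (Term n m)
    termsOf (concept A t) = [ t ]
    termsOf (role r t t′) = t ∷ t′ ∷ []

    terms : List (Term n m)
    terms = concatMap termsOf ψ

    used : List Path
    used = map path terms

    used∈ : ∀ {α t} → α ∈ˡ ψ → t ∈ˡ termsOf α → path t ∈ˡ used
    used∈ α∈ t∈ = ∈-map⁺ path (∈-concatMap⁺ termsOf (lose α∈ t∈))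

    used-IsPath : ∀ {p} → p ∈ˡ used → IsPath p
    used-IsPath p∈ with ∈-map⁻ path p∈
    ... | t , _ , refl = proj₂ (termValue t)

    linkOf : Path → Atom n m → List RoleName
    linkOf q (concept A t) = []
    linkOf q (role r t t′) = guard (path t′ ≟ᵖ q) r

    -- If `q` is anonymous, all these query edges start at its parent, so a single successor has to
    -- satisfy them together. This is the origin of the role conjunctions.
    links : Path → List RoleName
    links q = concatMap (linkOf q) ψ

    links⁺ : ∀ {r t t′} → role r t t′ ∈ˡ ψ → r ∈ˡ links (path t′)
    links⁺ {r} {t} {t′} α∈ =
      ∈-concatMap⁺ (linkOf (path t′)) (lose α∈ (guard⁺ (path t′ ≟ᵖ path t′) refl))

    links⁻ : ∀ {r q} → r ∈ˡ links q → ∃₂ λ t t′ → role r t t′ ∈ˡ ψ × path t′ ≡ q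
    links⁻ {q = q} r∈ with find (∈-concatMap⁻ (linkOf q) {xs = ψ} r∈)
    ... | role r t t′ , α∈ , r∈α with guard⁻ (path t′ ≟ᵖ q) r∈α
    ...   | eq , refl = t , t′ , α∈ , eq

    conjunctsOf : (Path → Concept⊓u) → Path → Atom n m → List Concept⊓u
    conjunctsOf D p (concept A t) = guard (path t ≟ᵖ p) (name A)
    -- For an atom of `ψ`, `r` already belongs to the links; repeating it makes the list visibly
    -- nonempty.
    conjunctsOf D p (role r t t′) = guard (HasParent? (path t′) p) (∃⟨ r ∷ links (path t′) ⟩ D (path t′))

    -- The query atoms at p and at the paths that extend p along query edges, read as a tree up to depth k.
    queryConcept : ℕ → Path → Concept⊓u
    queryConcept zero    p = ⊤
    queryConcept (suc k) p = ⨅⊓u (concatMap (conjunctsOf (queryConcept k) p) ψ)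

    queryConcept-conjunct : ∀ {ℐ k p α C d} → α ∈ˡ ψ → C ∈ˡ conjunctsOf (queryConcept k) p α →
                            ⟦_⟧⊓u ℐ (queryConcept (suc k) p) d → ⟦_⟧⊓u ℐ C d
    queryConcept-conjunct {ℐ} {k} {p} α∈ C∈ d∈ =
      ⨅⊓u⁻ ℐ (concatMap (conjunctsOf (queryConcept k) p) ψ) d∈ (∈-concatMap⁺ (conjunctsOf (queryConcept k) p) (lose α∈ C∈))

    sig-links : ∀ q → ⋃sig (λ r s → inj₂ r ≡ s) (links q) ⊆ ⋃sig sigAtom ψ
    sig-links q s∈ with find s∈
    ... | r , r∈ , refl with links⁻ r∈
    ...   | _ , _ , α∈ , _ = lose α∈ refl

    sig-queryConcept : ∀ k p → sigConcept⊓u (queryConcept k p) ⊆ ⋃sig sigAtom ψ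
    sig-queryConcept (suc k) p = sig-⨅⊓u _ conjunct
      where
      conjunctOf : ∀ α → α ∈ˡ ψ → ∀ {C} → C ∈ˡ conjunctsOf (queryConcept k) p α → sigConcept⊓u C ⊆ ⋃sig sigAtom ψ
      conjunctOf (concept A t) α∈ C∈ s∈ with guard⁻ (path t ≟ᵖ p) C∈
      ... | _ , refl = lose α∈ s∈
      conjunctOf (role r t t′) α∈ C∈ s∈ with guard⁻ (HasParent? (path t′) p) C∈
      conjunctOf (role r t t′) α∈ C∈ (inj₁ (here eq))  | _ , refl = lose α∈ eq
      conjunctOf (role r t t′) α∈ C∈ (inj₁ (there s∈)) | _ , refl = sig-links (path t′) s∈
      conjunctOf (role r t t′) α∈ C∈ (inj₂ s∈)         | _ , refl = sig-queryConcept k (path t′) s∈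
      conjunct : ∀ {C} → C ∈ˡ concatMap (conjunctsOf (queryConcept k) p) ψ → sigConcept⊓u C ⊆ ⋃sig sigAtom ψ
      conjunct C∈ with find (∈-concatMap⁻ (conjunctsOf (queryConcept k) p) {xs = ψ} C∈)
      ... | α , α∈ , C∈α = conjunctOf α α∈ C∈α

    module _ {ℐ : Interpretation} (ℐ⊨𝒯 : ℐ ⊨ᵀ 𝒯) where

      -- The next restriction on a path is entailed at its tail, and each query role into the child
      -- is a super-role of the one in that restriction, because the match holds in the canonical
      -- model.
      queryConcept-sound : ∀ k p → IsPath p → Described depth (tail p) ℐ ⊆ ⟦_⟧⊓u ℐ (queryConcept k p)
      queryConcept-sound zero    p isPath d∈ = _
      queryConcept-sound (suc k) p isPath {d} d∈ = ⨅⊓u⁺ ℐ _ conjunct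
        where
        childConjunct : ∀ r q → parent q ≡ just p → IsPath q → r ∈ˡ links q →
                        ⟦_⟧⊓u ℐ (∃⟨ r ∷ links q ⟩ queryConcept k q) d
        childConjunct r q@(a , (s , E) ∷ es) refl isPath@(e∈ , _) r∈ with exsAt-sound e∈ ℐ ℐ⊨𝒯 d∈
        ... | d′ , sdd′ , d′∈ =
          d′ , link r∈ ∷ All.tabulate link , queryConcept-sound k q isPath ((d , sdd′) , d′∈)
          where
          link : ∀ {r} → r ∈ˡ links q → ⟦_⟧ʳ ℐ r d d′
          link r∈ with links⁻ r∈
          ... | t , t′ , α∈ , eq with subst (PathEdge _ (path t)) eq (All.lookup match α∈)
          ...   | _ , r∈s = supers-sound 𝒯 s r∈s ℐ ℐ⊨𝒯 sdd′
        conjunctOf : ∀ α → α ∈ˡ ψ → ∀ {C} → C ∈ˡ conjunctsOf (queryConcept k) p α → ⟦_⟧⊓u ℐ C d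
        conjunctOf (concept A t) α∈ C∈ with guard⁻ (path t ≟ᵖ p) C∈
        ... | eq , refl = labelsAt-sound (subst (λ p → A ∈ˡ labelsAt (tail p)) eq (All.lookup match α∈)) ℐ ℐ⊨𝒯 d∈
        conjunctOf (role r t t′) α∈ C∈ with guard⁻ (HasParent? (path t′) p) C∈
        ... | eq , refl = childConjunct r (path t′) eq (proj₂ (termValue t′)) (links⁺ α∈)
        conjunct : ∀ {C} → C ∈ˡ concatMap (conjunctsOf (queryConcept k) p) ψ → ⟦_⟧⊓u ℐ C d
        conjunct C∈ with find (∈-concatMap⁻ (conjunctsOf (queryConcept k) p) {xs = ψ} C∈)
        ... | α , α∈ , C∈α = conjunctOf α α∈ C∈α

      -- Supplies the element for ∃u. The walk along the path may use roles outside the signature,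
      -- and the universal role forgets them.
      path-inhabited : ∀ a es → IsPath (a , es) → ∀ {d} → Described depth (ind (vertex a)) ℐ d →
                       ∃ (Described depth (tail (a , es)) ℐ)
      path-inhabited a []       _           d∈ = _ , d∈
      path-inhabited a (e ∷ es) (e∈ , isPath) d∈ with path-inhabited a es isPath d∈
      ... | d′ , d′∈ with exsAt-sound e∈ ℐ ℐ⊨𝒯 d′∈
      ...   | d″ , r , d″∈ = d″ , (d′ , r) , d″∈

    abstract
      maxLength : ℕ
      maxLength = max 0 (map (length ∘ proj₂) used)

      used-length : ∀ {p} → p ∈ˡ used → length (proj₂ p) ≤ maxLength
      used-length p∈ = All.lookup (xs≤max 0 (map (length ∘ proj₂) used)) (∈-map⁺ (length ∘ proj₂) p∈)

    -- A child has exactly one unit less than its parent, so the successor demanded by the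
    -- `fullConcept` of a used path satisfies the `fullConcept` of the child. The extra unit keeps
    -- the fuel of the longest used path positive, so that its concept atoms are still read.
    fuel : Path → ℕ
    fuel p = suc maxLength ∸ length (proj₂ p)

    fullConcept : Path → Concept⊓u
    fullConcept p = queryConcept (fuel p) p

    fullConcept-conjunct : ∀ {ℐ p α C d} → α ∈ˡ ψ → p ∈ˡ used →
                           C ∈ˡ conjunctsOf (queryConcept (maxLength ∸ length (proj₂ p))) p α →
                           ⟦_⟧⊓u ℐ (fullConcept p) d → ⟦_⟧⊓u ℐ C d
    fullConcept-conjunct {ℐ} {p} {d = d} α∈ p∈ C∈ d∈ = queryConcept-conjunct {k = maxLength ∸ length (proj₂ p)} α∈ C∈
      (subst (λ k → ⟦_⟧⊓u ℐ (queryConcept k p) d) (ℕ.+-∸-assoc 1 (used-length p∈)) d∈)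

    -- Conditions on ℐ that, over all used paths and all atoms of the query, yield a match in ℐ.
    PathCondition : Path → Interpretation → Set
    PathCondition p@(a , [])    ℐ = ⟦_⟧⊓u ℐ (fullConcept p) (⟦_⟧ⁱ ℐ a)
    PathCondition p@(_ , _ ∷ _) ℐ = ∃ (⟦_⟧⊓u ℐ (fullConcept p))

    EdgeCondition : RoleName → Path → Path → Interpretation → Set
    EdgeCondition r (a , []) (b , []) ℐ = ⟦_⟧ʳ ℐ r (⟦_⟧ⁱ ℐ a) (⟦_⟧ⁱ ℐ b)
    EdgeCondition r _        _        ℐ = Unit.⊤

    AtomCondition : Atom n m → Interpretation → Set
    AtomCondition (concept A t) ℐ = Unit.⊤
    AtomCondition (role r t t′) ℐ = EdgeCondition r (path t) (path t′) ℐ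

    module _ {ℐ : Interpretation} (paths : ∀ {p} → p ∈ˡ used → PathCondition p ℐ)
             (atoms : ∀ {α} → α ∈ˡ ψ → AtomCondition α ℐ) where

      open import Data.List.Membership.DecPropositional _≟ᵖ_ using (_∈?_)

      Located : Path → Pred (Δ ℐ) 0ℓ
      Located p d = p ∈ˡ used → ⟦_⟧⊓u ℐ (fullConcept p) d

      locateStep : ∀ a e es {d} → Located (a , es) d →
                   ∃ λ d′ → Located (a , e ∷ es) d′ × (∀ {r} → r ∈ˡ links (a , e ∷ es) → ⟦_⟧ʳ ℐ r d d′)
      locateStep a e es located with (a , e ∷ es) ∈? used
      -- No term takes this path as its value and no query edge enters it, so any element serves.
      ... | no  p∉ = nonempty ℐ , (λ p∈ → contradiction p∈ p∉) , λ r∈ → contradiction (linked∈ r∈) p∉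
        where
        linked∈ : ∀ {r} → r ∈ˡ links (a , e ∷ es) → (a , e ∷ es) ∈ˡ used
        linked∈ r∈ with links⁻ r∈
        ... | t , t′ , α∈ , eq = subst (_∈ˡ used) eq (used∈ α∈ (there (here refl)))
      ... | yes p∈ with member? (links (a , e ∷ es))
      -- No query edge enters this path: it is the top of a tree of the query, to be placed by its
      -- ∃u inclusion.
      ...   | inj₂ none = let d′ , d′∈ = paths p∈ in d′ , (λ _ → d′∈) , λ r∈ → contradiction r∈ none
      ...   | inj₁ (r , r∈) with links⁻ r∈
      -- By the tree shape the link starts at the parent, which is therefore used too, and its full
      -- concept demands this child.
      ...     | t , t′ , α∈ , eq with subst (PathEdge r (path t)) eq (All.lookup match α∈)
      ...       | eq′ , _ = child (fullConcept-conjunct α∈ parent∈ conjunct∈ (located parent∈))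
        where
        parent∈ : (a , es) ∈ˡ used
        parent∈ = subst (_∈ˡ used) eq′ (used∈ α∈ (here refl))
        k = maxLength ∸ length es
        conjunct∈ : (∃⟨ r ∷ links (a , e ∷ es) ⟩ queryConcept k (a , e ∷ es)) ∈ˡ
                    conjunctsOf (queryConcept k) (a , es) (role r t t′)
        conjunct∈ = subst (λ q → (∃⟨ r ∷ links q ⟩ queryConcept k q) ∈ˡ conjunctsOf (queryConcept k) (a , es) (role r t t′)) eq
          (guard⁺ (HasParent? (path t′) (a , es)) (cong parent eq))
        child : ∀ {d} → ⟦_⟧⊓u ℐ (∃⟨ r ∷ links (a , e ∷ es) ⟩ queryConcept k (a , e ∷ es)) d →
                ∃ λ d′ → Located (a , e ∷ es) d′ × (∀ {r} → r ∈ˡ links (a , e ∷ es) → ⟦_⟧ʳ ℐ r d d′)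
        child (d′ , _ ∷ edges , d′∈) = d′ , (λ _ → d′∈) , All.lookup edges

      -- Elements are chosen along paths, not term by term: terms with equal paths agree, and each
      -- child is chosen relative to its parent.
      locate : ∀ a es → ∃ (Located (a , es))
      locate a []       = ⟦_⟧ⁱ ℐ a , paths
      locate a (e ∷ es) = let d , located , _ = locateStep a e es (proj₂ (locate a es)) in d , located

      image : Path → Δ ℐ
      image (a , es) = proj₁ (locate a es)

      image-edge : ∀ {r t t′} → role r t t′ ∈ˡ ψ → ⟦_⟧ʳ ℐ r (image (path t)) (image (path t′))
      image-edge {r} {t} {t′} α∈ with path t | path t′ | All.lookup match α∈ | atoms α∈ | links⁺ α∈
      ... | a , .[] | b , []     | refl , _ | edge | _  = edge
      ... | _       | b , e ∷ es | refl , _ | _    | r∈ = proj₂ (proj₂ (locateStep b e es (proj₂ (locate b es)))) r∈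

      matches : ℐ ⊨q (query m ψ at a⃗)
      matches = image ∘ path ∘ quantifiedVar , All.tabulate λ {α} → atom α
        where
        π : Fin n → Δ ℐ
        π i = ⟦_⟧ⁱ ℐ (lookup a⃗ i)
        ρ′ : Fin m → Δ ℐ
        ρ′ = image ∘ path ∘ quantifiedVar
        image-term : ∀ t → image (path t) ≡ ⟦_⟧ᵗ ℐ π ρ′ t
        image-term (individual a)    = refl
        image-term (answerVar i)     = refl
        image-term (quantifiedVar j) = refl
        atom : ∀ α → α ∈ˡ ψ → satisfiesAtom ℐ π ρ′ α
        atom (concept A t) α∈ = subst (⟦_⟧ᴬ ℐ A) (image-term t)
          (fullConcept-conjunct α∈ t∈ (guard⁺ (path t ≟ᵖ path t) refl) (proj₂ (uncurry locate (path t)) t∈))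
          where t∈ = used∈ α∈ (here refl)
        atom (role r t t′) α∈ rewrite sym (image-term t) | sym (image-term t′) = image-edge α∈

-- Finding a separating inclusion

module Separation (𝒯₁ 𝒯₂ : TBox) (𝒜 : ABox) (σ : Signature) where

  Separated : Set₁
  Separated = ∃ λ φ → 𝒯₁ entails φ × ¬ 𝒯₂ entails φ × sigInclusion φ ⊆ σ

  -- Refuting a conjunction does not constructively name a failing conjunct. This disjunction passes
  -- through finite conjunctions, and the assumption on `𝒯₂` is applied once, at the end.
  SeparatedOr : (Interpretation → Set) → Set₁
  SeparatedOr G = Separated ⊎ (∀ ℐ → ℐ ⊨ᵀ 𝒯₂ → ℐ ⊨ᴬ 𝒜 → G ℐ)

  separatedOr-map : ∀ {G H : Interpretation → Set} → (∀ ℐ → ℐ ⊨ᴬ 𝒜 → G ℐ → H ℐ) → SeparatedOr G → SeparatedOr H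
  separatedOr-map f (inj₁ separated) = inj₁ separated
  separatedOr-map f (inj₂ forced)    = inj₂ λ ℐ ℐ⊨𝒯₂ ℐ⊨𝒜 → f ℐ ℐ⊨𝒜 (forced ℐ ℐ⊨𝒯₂ ℐ⊨𝒜)

  separatedOr-× : ∀ {G H : Interpretation → Set} → SeparatedOr G → SeparatedOr H → SeparatedOr (λ ℐ → G ℐ × H ℐ)
  separatedOr-× (inj₁ separated) _                = inj₁ separated
  separatedOr-× (inj₂ _)         (inj₁ separated) = inj₁ separated
  separatedOr-× (inj₂ g)         (inj₂ h)         = inj₂ λ ℐ ℐ⊨𝒯₂ ℐ⊨𝒜 → g ℐ ℐ⊨𝒯₂ ℐ⊨𝒜 , h ℐ ℐ⊨𝒯₂ ℐ⊨𝒜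

  separatedOr-all : ∀ {G : A → Interpretation → Set} xs → (∀ {x} → x ∈ˡ xs → SeparatedOr (G x)) →
                    SeparatedOr (λ ℐ → All (λ x → G x ℐ) xs)
  separatedOr-all []       h = inj₂ λ _ _ _ → []
  separatedOr-all (x ∷ xs) h =
    separatedOr-map (λ _ _ (g , gs) → g ∷ gs) (separatedOr-× (h (here refl)) (separatedOr-all xs (h ∘ there)))

  separatedOr-elim : ∀ {G : Interpretation → Set} → SeparatedOr G →
                     ¬ (∀ ℐ → ℐ ⊨ᵀ 𝒯₂ → ℐ ⊨ᴬ 𝒜 → G ℐ) → Separated
  separatedOr-elim (inj₁ separated) _       = separated
  separatedOr-elim (inj₂ forced)    ¬forced = contradiction forced ¬forced

  separatedOr-inclusion : ∀ φ → 𝒯₁ entails φ → sigInclusion φ ⊆ σ → SeparatedOr (_⊨ φ)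
  separatedOr-inclusion φ entailed sig with entails? 𝒯₂ φ
  ... | yes entailed₂ = inj₂ λ ℐ ℐ⊨𝒯₂ _ → entailed₂ ℐ ℐ⊨𝒯₂
  ... | no ¬entailed₂ = inj₁ (φ , entailed , ¬entailed₂ , sig)

separate : ∀ 𝒯₁ 𝒯₂ 𝒜 q → 𝒯₁ ⨾ 𝒜 entailsq q → ¬ 𝒯₂ ⨾ 𝒜 entailsq q →
           Separation.Separated 𝒯₁ 𝒯₂ 𝒜 (sigPair (𝒜 , q))
separate 𝒯₁ 𝒯₂ 𝒜 q@(query m ψ at a⃗) entailed₁ ¬entailed₂ =
  separatedOr-elim
    (separatedOr-map (λ _ _ (paths , atoms) → matches ρ match (All.lookup paths) (All.lookup atoms))
      (separatedOr-× (separatedOr-all (used ρ match) λ {p} p∈ → pathCondition p (used-IsPath ρ match p∈))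
                     (separatedOr-all ψ λ {α} → atomCondition α)))
    ¬entailed₂
  where
  open QueryMatch 𝒯₁ 𝒜 ψ a⃗
  open Separation 𝒯₁ 𝒯₂ 𝒜 (sigPair (𝒜 , q))
  model-match : model ⊨q q
  model-match = entailed₁ model model⊨𝒯 model⊨𝒜
  ρ     = proj₁ model-match
  match = proj₂ model-match
  sig-individual : ∀ a → sigConceptRan (unravel depth (vertex a)) ⊆ sigPair (𝒜 , q)
  sig-individual a s∈ = inj₁ (sig-unravel {sigABox 𝒜} label edge depth (vertex a) s∈)
    where
    open Graph aboxGraph
    label : ∀ {A v} → (A , v) ∈ˡ labels → sigABox 𝒜 (inj₁ A)
    label l∈ with labels⁻ l∈
    ... | _ , _ , α∈ = lose α∈ refl
    edge : ∀ {r e} → (r , e) ∈ˡ edges → sigABox 𝒜 (inj₂ r)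
    edge e∈ with edges⁻ e∈
    ... | _ , _ , _ , _ , α∈ = lose α∈ refl
  sig-inclusion : ∀ a p → sigInclusion (unravel depth (vertex a) ⊑ fullConcept ρ match p) ⊆ sigPair (𝒜 , q)
  sig-inclusion a p (inj₁ s∈) = sig-individual a s∈
  sig-inclusion a p (inj₂ s∈) = inj₂ (sig-queryConcept ρ match (fuel ρ match p) p s∈)
  pathCondition : ∀ p → IsPath p → SeparatedOr (PathCondition ρ match p)
  pathCondition p@(a , []) isPath = separatedOr-map (λ ℐ ℐ⊨𝒜 h → h (individual-unravel ℐ⊨𝒜 depth a))
    (separatedOr-inclusion (unravel depth (vertex a) ⊑ fullConcept ρ match p)
      (λ ℐ ℐ⊨𝒯₁ → queryConcept-sound ρ match ℐ⊨𝒯₁ (fuel ρ match p) p isPath)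
      (sig-inclusion a p))
  pathCondition p@(a , es@(_ ∷ _)) isPath = separatedOr-map (λ ℐ ℐ⊨𝒜 h → h (individual-unravel ℐ⊨𝒜 depth a))
    -- The left side describes the root of the path. If that root is served by `nothing`, it is
    -- equivalent to ⊤.
    (separatedOr-inclusion (unravel depth (vertex a) ⊑ ∃u fullConcept ρ match p)
      (λ ℐ ℐ⊨𝒯₁ d∈ → let d′ , d′∈ = path-inhabited ρ match ℐ⊨𝒯₁ a es isPath d∈
                      in d′ , queryConcept-sound ρ match ℐ⊨𝒯₁ (fuel ρ match p) p isPath d′∈)
      (sig-inclusion a p))
  edgeCondition : ∀ r p p′ → sigQuery (query m ψ) (inj₂ r) → PathEdge r p p′ → SeparatedOr (EdgeCondition ρ match r p p′)
  edgeCondition r (a , _ ∷ _) _           r∈ _       = inj₂ _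
  edgeCondition r (a , [])    (b , _ ∷ _) r∈ _       = inj₂ _
  edgeCondition r (a , [])    (b , [])    r∈ (_ , e) with BaseEdge-sound e
  -- An edge between roots comes from an asserted role `s` below `r`. The ABox contributes `s` and
  -- the query `r`, so the inclusion stays within the signature.
  ... | s , e∈ , r∈s with edges⁻ e∈
  ...   | a′ , b′ , eqa , eqb , α∈ with refl ← vertex-just eqa | refl ← vertex-just eqb =
    separatedOr-map (λ ℐ ℐ⊨𝒜 h → h (All.lookup ℐ⊨𝒜 α∈))
      (separatedOr-inclusion (s ⊑ʳ r) (supers-sound 𝒯₁ s r∈s)
        λ { (inj₁ refl) → inj₁ (lose α∈ refl) ; (inj₂ refl) → inj₂ r∈ })
  atomCondition : ∀ α → α ∈ˡ ψ → SeparatedOr (AtomCondition ρ match α)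
  atomCondition (concept A t) α∈ = inj₂ _
  atomCondition (role r t t′) α∈ =
    edgeCondition r (path ρ match t) (path ρ match t′) (lose α∈ refl) (All.lookup match α∈)

lemma63 : (𝒯₁ 𝒯₂ : TBox) (Σ : Signature) (φ : ABox × QueryInstance) →
    φ ∈ qDiff Σ 𝒯₁ 𝒯₂ →
    ∃ λ (φ′ : ELran⊓uInclusion) → φ′ ∈ cDiff Σ 𝒯₁ 𝒯₂ × sigInclusion φ′ ⊆ sigPair φ
lemma63 𝒯₁ 𝒯₂ Σ (𝒜 , q) (sig𝒜 , sigq , _ , entailed₁ , ¬entailed₂) =
  let φ′ , entailed , ¬entailed , sig = separate 𝒯₁ 𝒯₂ 𝒜 q entailed₁ ¬entailed₂
  in φ′ , (inΣ ∘ sig , entailed , ¬entailed) , sig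
  where
  inΣ : sigPair (𝒜 , q) ⊆ Σ
  inΣ (inj₁ s∈) = sig𝒜 s∈
  inΣ (inj₂ s∈) = sigq s∈
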